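{- Let $n \geq 2$ and let $G_1,\ldots,G_n$ be vertex-disjoint graphs, each of which is either a chordal graph or a cycle. Let $G$ be any vertex-gluing of $G_1,\ldots,G_n$ (obtained from their disjoint union by choosing $u_i \in V(G_i)$ for each $i$ and identifying $u_1,\ldots,u_n$ as a single vertex). Then for every $m \in \mathbb{N}$, \[ P_{DP}(G,m) = \frac{\prod_{i=1}^{n} P_{DP}(G_i,m)}{m^{n-1}}. \]
   Context: All graphs are finite and simple. A cover of a graph $G$ is a pair $\mathcal{H}=(L,H)$ where $H$ is a graph and $L: V(G) \to \mathcal{P}(V(H))$ satisfies: (1) $\{L(u): u \in V(G)\}$ is a partition of $V(H)$ into $|V(G)|$ parts; (2) $H[L(u)]$ is complete for each $u$; (3) if there is an edge of $H$ between $L(u)$ and $L(v)$ with $u \neq v$, then $uv \in E(G)$; (4) if $uv \in E(G)$, the edges of $H$ between $L(u)$ and $L(v)$ form a (possibly empty) matching. The cover is $m$-fold if $|L(u)|=m$ for all $u$. An $\mathcal{H}$-coloring of $G$ is an independent set of $H$ of size $|V(G)|$. $P_{DP}(G,m)$ is the minimum number of $\mathcal{H}$-colorings of $G$ over all $m$-fold covers $\mathcal{H}$ of $G$. -}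

module Defs where

open import Data.Nat using (ℕ; zero; suc; _+_; _*_; _≡ᵇ_)
open import Data.Nat.DivMod using (_mod_)
open import Data.Bool using (Bool; true; false; _∧_; not; if_then_else_)
open import Data.Fin using (Fin; toℕ)
import Data.Fin as Fin
import Data.Nat
open import Data.Fin.Subset using (Subset; _∈_; ∣_∣)
open import Data.Vec using (Vec; []; _∷_; lookup)
open import Data.List using (List; []; _∷_; map; _++_)
open import Data.List using () renaming (allFin to allFinL)
open import Data.Product using (Σ; ∃; ∃-syntax; _×_; _,_)
open import Data.Sum using (_⊎_)
open import Relation.Binary.PropositionalEquality using (_≡_; _≢_)
open import Relation.Nullary using (¬_)
open import Function.Bundles using (_↔_; _⇔_; Inverse)
open import Function.Definitions using (Injective)

record Graph (k : ℕ) : Set where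
  field
    adj   : Fin k → Fin k → Bool
    sym   : ∀ x y → adj x y ≡ adj y x
    irrefl : ∀ x → adj x x ≡ false
open Graph public

csuc : ∀ {l} → Fin (suc l) → Fin (suc l)
csuc {l} i = suc (toℕ i) mod (suc l)

IsCycleIn : ∀ {k} → Graph k → (l : ℕ) → (Fin (suc l) → Fin k) → Set
IsCycleIn G l f = Injective _≡_ _≡_ f × (∀ i → adj G (f i) (f (csuc i)) ≡ true)

HasChord : ∀ {k} → Graph k → (l : ℕ) → (Fin (suc l) → Fin k) → Set
HasChord G l f = ∃[ i ] ∃[ j ] (i ≢ j × j ≢ csuc i × i ≢ csuc j × adj G (f i) (f j) ≡ true)

Chordal : ∀ {k} → Graph k → Set
Chordal {k} G = ∀ (l : ℕ) (f : Fin (4 + l) → Fin k) → IsCycleIn G (3 + l) f → HasChord G (3 + l) f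

cycleAdj : ∀ {l} → Fin (suc l) → Fin (suc l) → Set
cycleAdj a b = (b ≡ csuc a) ⊎ (a ≡ csuc b)

IsCycleGraph : ∀ {k} → Graph k → Set
IsCycleGraph {k} G = Σ ℕ λ j → Σ (Fin k ↔ Fin (3 + j)) λ σ →
  ∀ u v → (adj G u v ≡ true ⇔ cycleAdj (Inverse.to σ u) (Inverse.to σ v))

record Cover {k : ℕ} (G : Graph k) (m : ℕ) : Set where
  field
    N : ℕ
    H : Graph N
    L : Fin k → Subset N
    cover    : ∀ (x : Fin N) → ∃[ u ] (x ∈ L u)
    disjoint : ∀ (x : Fin N) u v → x ∈ L u → x ∈ L v → u ≡ v
    mfold    : ∀ u → ∣ L u ∣ ≡ m
    clique   : ∀ u x y → x ∈ L u → y ∈ L u → x ≢ y → adj H x y ≡ true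
    edges    : ∀ u v x y → u ≢ v → x ∈ L u → y ∈ L v → adj H x y ≡ true → adj G u v ≡ true
    -- (4) if uv ∈ E(G), the H-edges between L(u) and L(v) form a matching
    --     (stated for all ordered pairs (u , v), hence in both directions)
    matching : ∀ u v → adj G u v ≡ true → ∀ x y y′ → x ∈ L u → y ∈ L v → y′ ∈ L v →
               adj H x y ≡ true → adj H x y′ ≡ true → y ≡ y′

subsets : ∀ N → List (Subset N)
subsets zero    = [] ∷ []
subsets (suc N) = map (true ∷_) (subsets N) ++ map (false ∷_) (subsets N)

allB : ∀ {A : Set} → (A → Bool) → List A → Bool
allB p []       = true
allB p (a ∷ as) = p a ∧ allB p as

independentB : ∀ {N} → Graph N → Subset N → Bool
independentB {N} H S =
  allB (λ x → allB (λ y → not (lookup S x ∧ lookup S y ∧ adj H x y)) (allFinL N)) (allFinL N)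

countB : ∀ {A : Set} → (A → Bool) → List A → ℕ
countB p []       = 0
countB p (a ∷ as) = (if p a then 1 else 0) + countB p as

numColorings : ∀ {k m} {G : Graph k} → Cover G m → ℕ
numColorings {k} 𝓗 =
  countB (λ S → independentB (Cover.H 𝓗) S ∧ (∣ S ∣ ≡ᵇ k)) (subsets (Cover.N 𝓗))

IsPDP : ∀ {k} → Graph k → ℕ → ℕ → Set
IsPDP G m p = (∃[ 𝓗 ] (numColorings {m = m} {G = G} 𝓗 ≡ p))
            × (∀ (𝓗 : Cover G m) → p Data.Nat.≤ numColorings 𝓗)

record IsVertexGluing {n : ℕ} {k : Fin n → ℕ} (Gs : (i : Fin n) → Graph (k i))
       (u : (i : Fin n) → Fin (k i)) {K : ℕ} (G : Graph K)
       (φ : (i : Fin n) → Fin (k i) → Fin K) : Set where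
  field
    surj      : ∀ a → ∃[ i ] ∃[ x ] (φ i x ≡ a)
    injEach   : ∀ i x y → φ i x ≡ φ i y → x ≡ y
    onlyGlue  : ∀ i j x y → i ≢ j → φ i x ≡ φ j y → (x ≡ u i × y ≡ u j)
    glue      : ∀ i j → φ i (u i) ≡ φ j (u j)
    edgesG    : ∀ a b → (adj G a b ≡ true ⇔
                  (∃[ i ] ∃[ x ] ∃[ y ] (φ i x ≡ a × φ i y ≡ b × adj (Gs i) x y ≡ true)))

prodFin : ∀ {n} → (Fin n → ℕ) → ℕ
prodFin {zero}  f = 1
prodFin {suc n} f = f Fin.zero * prodFin (λ i → f (Fin.suc i))

{-# OPTIONS --safe #-}
module Submission where

-- Call (G, u) uniform with value P when, in every m-fold cover, each colour of
-- L(u) lies in at least P colourings, and some cover has exactly P colourings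
-- through each colour of L(u).  Then P_DP(G, m) = m P.  The colourings of a
-- vertex-gluing through a fixed colour of the glued vertex are tuples of
-- colourings of the pieces, so values multiply, and the formula follows.
--
-- A chordal graph on at least two vertices has a simplicial vertex v ≠ u
-- (Dirac).  Deleting it divides the value by m ∸ deg v: a colouring of G − v
-- always leaves at least m ∸ deg v colours free at v, and exactly that many in
-- the cover given by identity matchings.
--
-- Colourings of a cycle through a given colour of u are closed walks through
-- the successive matchings.  For m ≥ 2, comparing two steps of the recursion shows that
-- their number is minimal when all matchings are the identity, except that for
-- even length the closing one is a fixed-point-free permutation.

open import Defs hiding (sym)
import Data.Nat.Properties
open import Algebra.Properties.CommutativeMonoid.Sum Data.Nat.Properties.+-0-commutativeMonoid using (sum; sum-remove; sum-cong-≗; ∑-comm; ∑-distrib-+; sum-replicate-zero)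
open import Algebra.Properties.Semiring.Sum Data.Nat.Properties.+-*-semiring using (*-distribˡ-sum)
open import Data.Bool using (Bool; true; false; _∧_; not)
open import Data.Bool.Properties using (¬-not) renaming (_≟_ to _≟ᵇ_)
open import Data.Fin using (Fin; zero; suc; toℕ; combine; remQuot; inject≤; punchIn; punchOut; splitAt; _↑ˡ_; _↑ʳ_)
open import Data.Fin.Properties using (_≟_; any?; all?; ¬∀⟶∃¬; injective⇒≤; suc-injective; toℕ-injective; toℕ<n; toℕ≤pred[n]; toℕ-fromℕ<; toℕ-inject≤; inject≤-injective; combine-injective; combine-remQuot; remQuot-combine; punchIn-injective; punchInᵢ≢i; punchIn-punchOut; punchOut-injective; splitAt-↑ˡ; splitAt-↑ʳ; splitAt⁻¹-↑ˡ; splitAt⁻¹-↑ʳ)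
open import Data.Fin.Subset using (Subset; _∈_; _∉_; ∣_∣; _∪_; ⁅_⁆; ⊤; ∁)
open import Data.Fin.Subset.Properties using (_∈?_; ∈⊤; ⊆-antisym; x∈⁅x⁆; x∈⁅y⁆⇒x≡y; x∈p∪q⁻; p⊆p∪q; q⊆p∪q; p⊂q⇒∣p∣<∣q∣; p⊂q⇒∁p⊃∁q; ∣∁p∣≡n∸∣p∣; x∈∁p⇒x∉p; x∉p⇒x∈∁p)
open import Data.List using (List; []; _∷_; map) renaming (allFin to allFinL)
open import Data.List.Membership.Propositional using () renaming (_∈_ to _∈ₗ_)
open import Data.List.Membership.Propositional.Properties using (∈-allFin; ∈-map⁺; ∈-map⁻; ∈-++⁺ˡ; ∈-++⁺ʳ)
open import Data.List.Relation.Unary.All as All using ()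
open import Data.List.Relation.Unary.AllPairs using ([]; _∷_)
open import Data.List.Relation.Unary.Any using (here; there)
open import Data.List.Relation.Unary.Unique.Propositional using (Unique)
open import Data.List.Relation.Unary.Unique.Propositional.Properties using (map⁺; ++⁺)
open import Data.Nat using (ℕ; zero; suc; _+_; _*_; _∸_; _^_; _≤_; _<_; _≡ᵇ_; NonZero; z≤n; s≤s; z<s; s<s; s≤s⁻¹) renaming (_≟_ to _≟ⁿ_; _<?_ to _<?ⁿ_)
open import Data.Nat.DivMod using (_%_; _mod_; m<n⇒m%n≡m; n%n≡0; %-distribˡ-+; m%n%n≡m%n; m%n<n; [m+n]%n≡m%n)
open import Data.Nat.Properties as ℕ hiding (_≟_; suc-injective)
open import Data.Product using (Σ; ∃; _×_; _,_; proj₁; proj₂)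
open import Data.Sum using (_⊎_; inj₁; inj₂; [_,_]′)
open import Data.Vec using ([]; _∷_; lookup; tabulate; here; there)
open import Data.Vec.Functional using (insertAt)
open import Data.Vec.Functional.Properties using (insertAt-lookup; insertAt-punchIn)
open import Data.Vec.Properties using ([]=⇒lookup; lookup⇒[]=; lookup∘tabulate; ∷-injectiveʳ)
open import Function using (_∘_; id; Inverse; Equivalence)
open import Function.Definitions using (Injective)
open import Relation.Binary using (tri<; tri≈; tri>)
open import Relation.Binary.Construct.Closure.ReflexiveTransitive as Star using (Star; ε; _◅_; _◅◅_)
open import Relation.Binary.PropositionalEquality using (_≡_; _≢_; _≗_; refl; sym; trans; cong; cong₂; subst; subst₂; module ≡-Reasoning)
open import Relation.Nullary using (¬_; Dec; yes; no; does; ¬?; contradiction)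
open import Relation.Nullary.Decidable using (_×-dec_; dec-true; dec-false)

-- The bounds are made colour by colour because totals do not multiply. If two pieces have `a c` and
-- `b c` colourings through colour `c`, the gluing has the sum of `a c * b c`, and a cover of the
-- gluing may align the rich colours of one piece with the poor colours of the other. A lower bound
-- on the totals alone therefore says too little; a lower bound at every colour, attained at every
-- colour by a single cover, removes the problem. For cycles with m colours and length l, the value
-- is ((m-1)^l - (m-1))/m for odd l and ((m-1)^l - 1)/m for even l; the recursion of `μ` produces
-- both without subtraction or division. A lower bound on the walks from one start is not inductive
-- by itself: the first matching removes one continuation, possibly the richest. So it is proved
-- together with a bound on the total minus any single entry, and each bound feeds the other one
-- step later.

true≢false : true ≢ false
true≢false ()

does-true : ∀ {P : Set} (d : Dec P) → does d ≡ true → P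
does-true (yes p) _ = p

does-false : ∀ {P : Set} (d : Dec P) → does d ≡ false → ¬ P
does-false (no ¬p) _ = ¬p

subst-Fin-injective : ∀ {r s} (eq : r ≡ s) {i j : Fin r} → subst Fin eq i ≡ subst Fin eq j → i ≡ j
subst-Fin-injective refl = id

-- Cardinalities of subsets

select : ∀ {n} {P : Fin n → Set} → (∀ x → Dec (P x)) → Subset n
select P? = tabulate (λ x → does (P? x))

∈-select⁺ : ∀ {n} {P : Fin n → Set} (P? : ∀ x → Dec (P x)) {x} → P x → x ∈ select P?
∈-select⁺ P? {x} px = lookup⇒[]= x _ (trans (lookup∘tabulate _ x) (dec-true (P? x) px))

∈-select⁻ : ∀ {n} {P : Fin n → Set} (P? : ∀ x → Dec (P x)) {x} → x ∈ select P? → P x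
∈-select⁻ P? {x} x∈ = does-true (P? x) (trans (sym (lookup∘tabulate _ x)) ([]=⇒lookup x∈))

enum : ∀ {n} (S : Subset n) → Fin ∣ S ∣ → Fin n
enum (true  ∷ S) zero    = zero
enum (true  ∷ S) (suc i) = suc (enum S i)
enum (false ∷ S) i       = suc (enum S i)

enum∈ : ∀ {n} (S : Subset n) i → enum S i ∈ S
enum∈ (true  ∷ S) zero    = here
enum∈ (true  ∷ S) (suc i) = there (enum∈ S i)
enum∈ (false ∷ S) i       = there (enum∈ S i)

enum-injective : ∀ {n} (S : Subset n) → Injective _≡_ _≡_ (enum S)
enum-injective (true  ∷ S) {zero}  {zero}  _  = refl
enum-injective (true  ∷ S) {suc i} {suc j} eq = cong suc (enum-injective S (suc-injective eq))
enum-injective (false ∷ S) eq = enum-injective S (suc-injective eq)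

rank : ∀ {n} (S : Subset n) {x} → x ∈ S → Fin ∣ S ∣
rank (true  ∷ S) here       = zero
rank (true  ∷ S) (there x∈) = suc (rank S x∈)
rank (false ∷ S) (there x∈) = rank S x∈

enum-rank : ∀ {n} (S : Subset n) {x} (x∈ : x ∈ S) → enum S (rank S x∈) ≡ x
enum-rank (true  ∷ S) here       = refl
enum-rank (true  ∷ S) (there x∈) = cong suc (enum-rank S x∈)
enum-rank (false ∷ S) (there x∈) = cong suc (enum-rank S x∈)

rank-injective : ∀ {n} (S : Subset n) {x y} (x∈ : x ∈ S) (y∈ : y ∈ S) →
                 rank S x∈ ≡ rank S y∈ → x ≡ y
rank-injective S x∈ y∈ eq = trans (sym (enum-rank S x∈)) (trans (cong (enum S) eq) (enum-rank S y∈))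

-- The map may use the membership proof, because the witnesses to which elements are charged below
-- are extracted from it.
∣∣-≤ : ∀ {n r} (S : Subset n) (g : ∀ x → x ∈ S → Fin r) →
       (∀ x y x∈ y∈ → g x x∈ ≡ g y y∈ → x ≡ y) → ∣ S ∣ ≤ r
∣∣-≤ S g inj = injective⇒≤ {f = λ i → g (enum S i) (enum∈ S i)}
  (λ eq → enum-injective S (inj _ _ _ _ eq))

∣∣-≥ : ∀ {n r} (S : Subset n) (g : Fin r → Fin n) → (∀ i → g i ∈ S) →
       Injective _≡_ _≡_ g → r ≤ ∣ S ∣
∣∣-≥ S g g∈ inj = injective⇒≤ {f = λ i → rank S (g∈ i)} (λ eq → inj (rank-injective S _ _ eq))

injective⇒surjective : ∀ {n} (f : Fin n → Fin n) → Injective _≡_ _≡_ f → ∀ y → ∃ λ x → f x ≡ y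
injective⇒surjective {suc n} f inj y with any? (λ x → f x ≟ y)
... | yes p = p
... | no ¬p = contradiction (injective⇒≤ {f = g} g-inj) (<⇒≱ (n<1+n n))
  where
  ne : ∀ x → y ≢ f x
  ne x eq = ¬p (x , sym eq)
  g : Fin (suc n) → Fin n
  g x = punchOut (ne x)
  g-inj : Injective _≡_ _≡_ g
  g-inj {x} {x′} eq = inj (punchOut-injective (ne x) (ne x′) eq)

-- Counting along a list

module _ {A : Set} (p : A → Bool) where

  pick : (xs : List A) → Fin (countB p xs) → A
  pick (a ∷ as) i with p a
  pick (a ∷ as) zero    | true = a
  pick (a ∷ as) (suc i) | true = pick as i
  ... | false = pick as i

  pick-holds : ∀ xs i → p (pick xs i) ≡ true
  pick-holds (a ∷ as) i with p a in eq
  pick-holds (a ∷ as) zero    | true = eq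
  pick-holds (a ∷ as) (suc i) | true = pick-holds as i
  ... | false = pick-holds as i

  pick∈ : ∀ xs i → pick xs i ∈ₗ xs
  pick∈ (a ∷ as) i with p a
  pick∈ (a ∷ as) zero    | true = here refl
  pick∈ (a ∷ as) (suc i) | true = there (pick∈ as i)
  ... | false = there (pick∈ as i)

  pick-injective : ∀ xs → Unique xs → Injective _≡_ _≡_ (pick xs)
  pick-injective (a ∷ as) (a∉ ∷ u) {i} {j} eq with p a
  pick-injective (a ∷ as) (a∉ ∷ u) {zero}  {zero}  eq | true = refl
  pick-injective (a ∷ as) (a∉ ∷ u) {zero}  {suc j} eq | true = contradiction eq (All.lookup a∉ (pick∈ as j))
  pick-injective (a ∷ as) (a∉ ∷ u) {suc i} {zero}  eq | true = contradiction (sym eq) (All.lookup a∉ (pick∈ as i))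
  pick-injective (a ∷ as) (a∉ ∷ u) {suc i} {suc j} eq | true = cong suc (pick-injective as u eq)
  ... | false = pick-injective as u eq

  place : ∀ xs {a} → a ∈ₗ xs → p a ≡ true → ∃ λ i → pick xs i ≡ a
  place (a ∷ as) (here refl) pa with p a
  ... | true = zero , refl
  place (b ∷ as) (there a∈) pa with p b
  ... | true  = let i , eq = place as a∈ pa in suc i , eq
  ... | false = place as a∈ pa

  countB-≥ : ∀ {n} xs (g : Fin n → A) → (∀ i → g i ∈ₗ xs) → (∀ i → p (g i) ≡ true) →
             Injective _≡_ _≡_ g → n ≤ countB p xs
  countB-≥ xs g g∈ pg inj = injective⇒≤ {f = λ i → proj₁ (pl i)}
    (λ {i} {j} eq → inj (trans (sym (proj₂ (pl i))) (trans (cong (pick xs) eq) (proj₂ (pl j)))))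
    where pl = λ i → place xs (g∈ i) (pg i)

  countB-≤ : ∀ {n} xs → Unique xs → (g : ∀ a → p a ≡ true → Fin n) →
             (∀ a b pa pb → g a pa ≡ g b pb → a ≡ b) → countB p xs ≤ n
  countB-≤ xs u g inj = injective⇒≤ {f = λ i → g (pick xs i) (pick-holds xs i)}
    (λ eq → pick-injective xs u (inj _ _ _ _ eq))

  allB⁺ : ∀ xs → (∀ a → p a ≡ true) → allB p xs ≡ true
  allB⁺ []       h = refl
  allB⁺ (a ∷ as) h rewrite h a = allB⁺ as h

  allB⁻ : ∀ xs → allB p xs ≡ true → ∀ {a} → a ∈ₗ xs → p a ≡ true
  allB⁻ (a ∷ as) h (here refl) with p a
  ... | true = refl
  allB⁻ (b ∷ as) h (there a∈) with p b
  ... | true = allB⁻ as h a∈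

-- Enumeration of subsets and the Boolean independence test

∈-subsets : ∀ {N} (S : Subset N) → S ∈ₗ subsets N
∈-subsets []          = here refl
∈-subsets {suc N} (true  ∷ S) = ∈-++⁺ˡ (∈-map⁺ (true ∷_) (∈-subsets S))
∈-subsets {suc N} (false ∷ S) = ∈-++⁺ʳ (map (true ∷_) (subsets N)) (∈-map⁺ (false ∷_) (∈-subsets S))

subsets-unique : ∀ N → Unique (subsets N)
subsets-unique zero    = All.[] ∷ []
subsets-unique (suc N) = ++⁺ (map⁺ ∷-injectiveʳ (subsets-unique N)) (map⁺ ∷-injectiveʳ (subsets-unique N))
  λ (x∈ , y∈) → differ (∈-map⁻ _ x∈) (∈-map⁻ _ y∈)
  where
  differ : ∀ {v : Subset (suc N)} → (∃ λ S → S ∈ₗ subsets N × v ≡ true ∷ S) →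
           ¬ (∃ λ S → S ∈ₗ subsets N × v ≡ false ∷ S)
  differ (_ , _ , refl) (_ , _ , ())

Independent : ∀ {N} → Graph N → Subset N → Set
Independent H S = ∀ x y → x ∈ S → y ∈ S → adj H x y ≡ false

independentB⁺ : ∀ {N} (H : Graph N) S → Independent H S → independentB H S ≡ true
independentB⁺ {N} H S ind = allB⁺ _ (allFinL N) λ x → allB⁺ _ (allFinL N) λ y → cell x y
  where
  cell : ∀ x y → not (lookup S x ∧ lookup S y ∧ adj H x y) ≡ true
  cell x y with lookup S x in ex | lookup S y in ey
  ... | false | _     = refl
  ... | true  | false = refl
  ... | true  | true  = cong not (ind x y (lookup⇒[]= x S ex) (lookup⇒[]= y S ey))

independentB⁻ : ∀ {N} (H : Graph N) S → independentB H S ≡ true → Independent H S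
independentB⁻ {N} H S h x y x∈ y∈
  with allB⁻ _ (allFinL N) (allB⁻ _ (allFinL N) h (∈-allFin x)) (∈-allFin y)
... | eq rewrite []=⇒lookup x∈ | []=⇒lookup y∈ = not-true _ eq
  where
  not-true : ∀ b → not b ≡ true → b ≡ false
  not-true false _ = refl

∧-true⁻ : ∀ {a b} → a ∧ b ≡ true → a ≡ true × b ≡ true
∧-true⁻ {true} {true} _ = refl , refl

≡ᵇ-true : ∀ {a b} → a ≡ b → (a ≡ᵇ b) ≡ true
≡ᵇ-true {zero}  refl = refl
≡ᵇ-true {suc a} refl = ≡ᵇ-true {a} refl

≡ᵇ-true⁻ : ∀ {a b} → (a ≡ᵇ b) ≡ true → a ≡ b
≡ᵇ-true⁻ {zero}  {zero}  _ = refl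
≡ᵇ-true⁻ {suc a} {suc b} h = cong suc (≡ᵇ-true⁻ h)

-- Labelled covers

-- The list of a vertex is Fin m, and E a b i j says that colour i at a
-- conflicts with colour j at b; its values off the edges of G are irrelevant.
record LCover {k} (G : Graph k) (m : ℕ) : Set where
  field
    E       : Fin k → Fin k → Fin m → Fin m → Bool
    E-sym   : ∀ a b i j → E a b i j ≡ E b a j i
    E-match : ∀ a b → adj G a b ≡ true → ∀ i j j′ →
              E a b i j ≡ true → E a b i j′ ≡ true → j ≡ j′

open LCover

Proper : ∀ {k m} {G : Graph k} → LCover G m → (Fin k → Fin m) → Set
Proper {G = G} C f = ∀ a b → adj G a b ≡ true → E C a b (f a) (f b) ≡ false

-- Without function extensionality, functions are counted up to pointwise equality.
AtLeast AtMost : ∀ {A B : Set} → ((A → B) → Set) → ℕ → Set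
AtLeast {A} {B} Q n = Σ (Fin n → A → B) λ f → (∀ i → Q (f i)) × (∀ i j → f i ≗ f j → i ≡ j)
AtMost  {A} {B} Q n = Σ (∀ f → Q f → Fin n) λ g → ∀ f f′ q q′ → g f q ≡ g f′ q′ → f ≗ f′

record Uniform {k} (G : Graph k) (u : Fin k) (m P : ℕ) : Set where
  field
    lower : ∀ (C : LCover G m) c → AtLeast (λ f → Proper C f × f u ≡ c) P
    best  : LCover G m
    upper : ∀ c → AtMost (λ f → Proper best f × f u ≡ c) P

-- Passing between covers and labelled covers

module Label {k m} {G : Graph k} (𝓗 : Cover G m) where
  open Cover 𝓗

  lab : Fin k → Fin m → Fin N
  lab a i = enum (L a) (subst Fin (sym (mfold a)) i)

  lab∈ : ∀ a i → lab a i ∈ L a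
  lab∈ a i = enum∈ (L a) _

  lab-injective : ∀ a i j → lab a i ≡ lab a j → i ≡ j
  lab-injective a i j eq = subst-Fin-injective (sym (mfold a)) (enum-injective (L a) eq)

  labelled : LCover G m
  labelled .E a b i j         = adj H (lab a i) (lab b j)
  labelled .E-sym a b i j     = Graph.sym H _ _
  labelled .E-match a b ab i j j′ e e′ =
    lab-injective b j j′ (matching a b ab _ _ _ (lab∈ a i) (lab∈ b j) (lab∈ b j′) e e′)

  image : (Fin k → Fin m) → Subset N
  image f = select (λ x → any? λ a → lab a (f a) ≟ x)

  ∣image∣ : ∀ f → ∣ image f ∣ ≡ k
  ∣image∣ f = ≤-antisym
    (∣∣-≤ (image f) (λ x x∈ → proj₁ (∈-select⁻ pre? x∈)) λ x y x∈ y∈ eq →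
      trans (sym (proj₂ (∈-select⁻ pre? x∈)))
        (trans (cong (λ a → lab a (f a)) eq) (proj₂ (∈-select⁻ pre? y∈))))
    (∣∣-≥ (image f) (λ a → lab a (f a)) (λ a → ∈-select⁺ pre? (a , refl))
      λ {a} {b} eq → disjoint _ a b (lab∈ a _) (subst (_∈ L b) (sym eq) (lab∈ b _)))
    where
    pre? : ∀ x → Dec (∃ λ a → lab a (f a) ≡ x)
    pre? x = any? λ a → lab a (f a) ≟ x

  image-independent : ∀ f → Proper labelled f → Independent H (image f)
  image-independent f prop x y x∈ y∈
    with ∈-select⁻ (λ x → any? λ a → lab a (f a) ≟ x) x∈ | ∈-select⁻ (λ x → any? λ a → lab a (f a) ≟ x) y∈
  ... | a , refl | b , refl with a ≟ b
  ... | yes refl = irrefl H _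
  ... | no a≢b with adj H (lab a (f a)) (lab b (f b)) in eq
  ... | false = refl
  ... | true  = trans (sym eq) (prop a b (edges a b _ _ a≢b (lab∈ a _) (lab∈ b _) eq))

  image-injective : ∀ f g → image f ≡ image g → f ≗ g
  image-injective f g eq a
    with ∈-select⁻ (λ x → any? λ b → lab b (g b) ≟ x)
           (subst (lab a (f a) ∈_) eq (∈-select⁺ (λ x → any? λ b → lab b (f b) ≟ x) (a , refl)))
  ... | b , e with disjoint _ b a (lab∈ b (g b)) (subst (_∈ L a) (sym e) (lab∈ a (f a)))
  ... | refl = sym (lab-injective a _ _ e)

  -- Arbitrary covers enter only through lower bounds, so an injection from proper labelled
  -- colourings to independent sets suffices here; the opposite bound is proved for `realised`
  -- covers.
  numColorings-≥ : ∀ {n} → AtLeast (Proper labelled) n → n ≤ numColorings 𝓗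
  numColorings-≥ (f , prop , inj) = countB-≥ _ (subsets N) (λ i → image (f i))
    (λ i → ∈-subsets _)
    (λ i → cong₂ _∧_ (independentB⁺ H _ (image-independent (f i) (prop i))) (≡ᵇ-true (∣image∣ (f i))))
    (λ eq → inj _ _ (image-injective _ _ eq))

module Realise {k m} {G : Graph k} (C : LCover G m) where

  vtx : Fin (k * m) → Fin k
  vtx x = proj₁ (remQuot m x)

  col : Fin (k * m) → Fin m
  col x = proj₂ (remQuot {k} m x)

  vtx-combine : ∀ a i → vtx (combine a i) ≡ a
  vtx-combine a i = cong proj₁ (remQuot-combine a i)

  vtx-col-injective : ∀ {x y} → vtx x ≡ vtx y → col x ≡ col y → x ≡ y
  vtx-col-injective {x} {y} e e′ =
    trans (sym (combine-remQuot {k} m x)) (trans (cong₂ combine e e′) (combine-remQuot {k} m y))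

  -- The decision is an argument, so that its properties can be proved by matching on it. The
  -- conjunction with `adj G a b` masks the arbitrary values of `E` off the edges of `G`.
  hadj : ∀ {a b : Fin k} → Dec (a ≡ b) → (i j : Fin m) → Bool
  hadj         (yes _) i j = not (does (i ≟ j))
  hadj {a} {b} (no _)  i j = adj G a b ∧ E C a b i j

  hadj-sym : ∀ {a b} (d : Dec (a ≡ b)) (d′ : Dec (b ≡ a)) i j → hadj d i j ≡ hadj d′ j i
  hadj-sym (yes _) (yes _) i j with i ≟ j | j ≟ i
  ... | yes _ | yes _ = refl
  ... | no _  | no _  = refl
  ... | yes p | no ¬q = contradiction (sym p) ¬q
  ... | no ¬p | yes q = contradiction (sym q) ¬p
  hadj-sym (yes p) (no ¬q) i j = contradiction (sym p) ¬q
  hadj-sym (no ¬p) (yes q) i j = contradiction (sym q) ¬p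
  hadj-sym (no _)  (no _)  i j = cong₂ _∧_ (Graph.sym G _ _) (E-sym C _ _ i j)

  hadj-irrefl : ∀ {a} (d : Dec (a ≡ a)) (i : Fin m) → hadj d i i ≡ false
  hadj-irrefl (yes _) i = cong not (dec-true (i ≟ i) refl)
  hadj-irrefl (no ¬p) i = contradiction refl ¬p

  Hr : Graph (k * m)
  Hr .adj x y     = hadj (vtx x ≟ vtx y) (col x) (col y)
  Hr .Graph.sym x y = hadj-sym (vtx x ≟ vtx y) (vtx y ≟ vtx x) (col x) (col y)
  Hr .irrefl x    = hadj-irrefl (vtx x ≟ vtx x) (col x)

  hadj-clique : ∀ {x y} (d : Dec (vtx x ≡ vtx y)) → vtx x ≡ vtx y → x ≢ y → hadj d (col x) (col y) ≡ true
  hadj-clique (yes p) _ ne = cong not (dec-false (_ ≟ _) (λ e → ne (vtx-col-injective p e)))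
  hadj-clique (no ¬p) p ne = contradiction p ¬p

  hadj-edge : ∀ {a b} (d : Dec (a ≡ b)) {i j} → a ≢ b → hadj d i j ≡ true →
              adj G a b ≡ true × E C a b i j ≡ true
  hadj-edge (yes p) ne e = contradiction p ne
  hadj-edge (no _)  ne e = ∧-true⁻ e

  hadj-false : ∀ {a b} (d : Dec (a ≡ b)) {i j} → hadj d i j ≡ false → adj G a b ≡ true → E C a b i j ≡ false
  hadj-false {a} (yes refl) e ab = contradiction (trans (sym ab) (irrefl G a)) true≢false
  hadj-false (no _) e ab rewrite ab = e

  Lr : Fin k → Subset (k * m)
  Lr a = select (λ x → vtx x ≟ a)

  vtx≡ : ∀ {a x} → x ∈ Lr a → vtx x ≡ a
  vtx≡ {a} = ∈-select⁻ (λ x → vtx x ≟ a)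

  realised : Cover G m
  realised = record
    { N = k * m ; H = Hr ; L = Lr
    ; cover    = λ x → vtx x , ∈-select⁺ (λ y → vtx y ≟ vtx x) refl
    ; disjoint = λ x a b x∈a x∈b → trans (sym (vtx≡ x∈a)) (vtx≡ x∈b)
    ; mfold    = λ a → ≤-antisym
        (∣∣-≤ (Lr a) (λ x _ → col x) λ x y x∈ y∈ e → vtx-col-injective (trans (vtx≡ x∈) (sym (vtx≡ y∈))) e)
        (∣∣-≥ (Lr a) (combine a) (λ i → ∈-select⁺ (λ x → vtx x ≟ a) (vtx-combine a i))
          λ e → proj₂ (combine-injective a _ a _ e))
    ; clique   = λ a x y x∈ y∈ ne → hadj-clique (vtx x ≟ vtx y) (trans (vtx≡ x∈) (sym (vtx≡ y∈))) ne
    ; edges    = λ a b x y a≢b x∈ y∈ e → subst₂ (λ a b → adj G a b ≡ true) (vtx≡ x∈) (vtx≡ y∈)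
        (proj₁ (hadj-edge (vtx x ≟ vtx y) (λ p → a≢b (trans (sym (vtx≡ x∈)) (trans p (vtx≡ y∈)))) e))
    ; matching = matching′
    }
    where
    matching′ : ∀ a b → adj G a b ≡ true → ∀ x y y′ → x ∈ Lr a → y ∈ Lr b → y′ ∈ Lr b →
                adj Hr x y ≡ true → adj Hr x y′ ≡ true → y ≡ y′
    matching′ a b ab x y y′ x∈ y∈ y′∈ e e′ with vtx≡ x∈ | vtx≡ y∈ | vtx≡ y′∈
    ... | refl | refl | q = vtx-col-injective (sym q) (E-match C _ _ ab (col x) (col y) (col y′)
        (proj₂ (hadj-edge (vtx x ≟ vtx y) ne e))
        (subst (λ c → E C (vtx x) c (col x) (col y′) ≡ true) q
          (proj₂ (hadj-edge (vtx x ≟ vtx y′) (λ p → ne (trans p q)) e′))))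
      where
      ne : vtx x ≢ vtx y
      ne p = true≢false (trans (sym (subst (λ c → adj G (vtx x) c ≡ true) (sym p) ab)) (irrefl G _))

  module Read (S : Subset (k * m)) (ind : Independent Hr S) (size : ∣ S ∣ ≡ k) where

    vtx-injective : ∀ {x y} → x ∈ S → y ∈ S → vtx x ≡ vtx y → x ≡ y
    vtx-injective {x} {y} x∈ y∈ eq with x ≟ y
    ... | yes p = p
    ... | no ne = contradiction
            (trans (sym (hadj-clique {x} {y} (vtx x ≟ vtx y) eq ne)) (ind x y x∈ y∈)) true≢false

    elem : Fin k → Fin (k * m)
    elem i = enum S (subst Fin (sym size) i)

    elem∈ : ∀ i → elem i ∈ S
    elem∈ i = enum∈ S _

    -- Lists are cliques, so `S` meets each list at most once; having `k` elements, it meets each of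
    -- the `k` lists.
    at : ∀ a → ∃ λ i → vtx (elem i) ≡ a
    at = injective⇒surjective (λ i → vtx (elem i)) λ eq →
      subst-Fin-injective (sym size) (enum-injective S (vtx-injective (elem∈ _) (elem∈ _) eq))

    colour : Fin k → Fin m
    colour a = col (elem (proj₁ (at a)))

    colour-vtx : ∀ {x} → x ∈ S → colour (vtx x) ≡ col x
    colour-vtx {x} x∈ = cong col (vtx-injective (elem∈ _) x∈ (proj₂ (at (vtx x))))

    ∈⇐ : ∀ {x} → col x ≡ colour (vtx x) → x ∈ S
    ∈⇐ {x} eq = subst (_∈ S) (vtx-col-injective (proj₂ (at (vtx x))) (sym eq)) (elem∈ _)

    colour-proper : Proper C colour
    colour-proper a b ab with at a | at b
    ... | i , refl | j , refl = hadj-false (vtx (elem i) ≟ vtx (elem j)) (ind _ _ (elem∈ i) (elem∈ j)) ab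

  numColorings-≤ : ∀ {n} → AtMost (Proper C) n → numColorings realised ≤ n
  numColorings-≤ (g , inj) = countB-≤ _ (subsets (k * m)) (subsets-unique (k * m))
    (λ S h → g (R.colour S (ind S h) (size S h)) (R.colour-proper S (ind S h) (size S h)))
    λ S T hS hT eq → same S T hS hT (inj _ _ _ _ eq)
    where
    module R = Read
    ind : ∀ S → independentB Hr S ∧ (∣ S ∣ ≡ᵇ k) ≡ true → Independent Hr S
    ind S h = independentB⁻ Hr S (proj₁ (∧-true⁻ h))
    size : ∀ S → independentB Hr S ∧ (∣ S ∣ ≡ᵇ k) ≡ true → ∣ S ∣ ≡ k
    size S h = ≡ᵇ-true⁻ (proj₂ (∧-true⁻ {independentB Hr S} h))
    incl : ∀ S T hS hT → R.colour S (ind S hS) (size S hS) ≗ R.colour T (ind T hT) (size T hT) →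
           ∀ {x} → x ∈ S → x ∈ T
    incl S T hS hT eq {x} x∈ = R.∈⇐ T (ind T hT) (size T hT)
      (trans (sym (R.colour-vtx S (ind S hS) (size S hS) x∈)) (eq (vtx x)))
    same : ∀ S T hS hT → R.colour S (ind S hS) (size S hS) ≗ R.colour T (ind T hT) (size T hT) → S ≡ T
    same S T hS hT eq = ⊆-antisym
      (incl S T hS hT eq) (incl T S hT hS (λ a → sym (eq a)))

-- From colourings through one colour to all colourings

module _ {k m P : ℕ} {G : Graph k} {u : Fin k} where

  -- An index is a pair of a colour of `u` and an index among the colourings through it; the value
  -- at `u` recovers the first component.
  atLeast-total : (C : LCover G m) → (∀ c → AtLeast (λ f → Proper C f × f u ≡ c) P) →
                  AtLeast (Proper C) (m * P)
  atLeast-total C h = f , (λ x → proj₁ (ok x)) , λ x y eq → inj x y eq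
    where
    f : Fin (m * P) → Fin k → Fin m
    f x = proj₁ (h (proj₁ (remQuot {m} P x))) (proj₂ (remQuot {m} P x))
    ok : ∀ x → Proper C (f x) × f x u ≡ proj₁ (remQuot {m} P x)
    ok x = proj₁ (proj₂ (h (proj₁ (remQuot {m} P x)))) (proj₂ (remQuot {m} P x))
    inj′ : ∀ c c′ i i′ → c ≡ c′ → proj₁ (h c) i ≗ proj₁ (h c′) i′ → combine c i ≡ combine c′ i′
    inj′ c c i i′ refl eq = cong (combine c) (proj₂ (proj₂ (h c)) i i′ eq)
    inj : ∀ x y → f x ≗ f y → x ≡ y
    inj x y eq = trans (sym (combine-remQuot {m} P x)) (trans
      (inj′ _ _ _ _ (trans (sym (proj₂ (ok x))) (trans (eq u) (proj₂ (ok y)))) eq)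
      (combine-remQuot {m} P y))

  atMost-total : (C : LCover G m) → (∀ c → AtMost (λ f → Proper C f × f u ≡ c) P) →
                 AtMost (Proper C) (m * P)
  atMost-total C h = (λ f q → combine (f u) (proj₁ (h (f u)) f (q , refl))) ,
    λ f f′ q q′ eq → let e , e′ = combine-injective _ _ _ _ eq in inj f f′ q q′ (f u) (f′ u) refl refl e e′
    where
    inj : ∀ f f′ q q′ c c′ (fc : f u ≡ c) (fc′ : f′ u ≡ c′) → c ≡ c′ →
          proj₁ (h c) f (q , fc) ≡ proj₁ (h c′) f′ (q′ , fc′) → f ≗ f′
    inj f f′ q q′ c c fc fc′ refl e = proj₂ (h c) f f′ (q , fc) (q′ , fc′) e

  uniform⇒PDP : Uniform G u m P → IsPDP G m (m * P)
  uniform⇒PDP U = (Realise.realised best , ≤-antisym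
      (Realise.numColorings-≤ best (atMost-total best upper)) (low (Realise.realised best))) , low
    where
    open Uniform U
    low : ∀ 𝓗 → m * P ≤ numColorings 𝓗
    low 𝓗 = Label.numColorings-≥ 𝓗 (atLeast-total (Label.labelled 𝓗) (lower (Label.labelled 𝓗)))

PDP-unique : ∀ {k} {G : Graph k} {m p q} → IsPDP G m p → IsPDP G m q → p ≡ q
PDP-unique ((𝓗 , refl) , lo) ((𝓗′ , refl) , lo′) = ≤-antisym (lo 𝓗′) (lo′ 𝓗)

-- Vertex gluings

encode : ∀ {n} (P : Fin n → ℕ) → (∀ i → Fin (P i)) → Fin (prodFin P)
encode {zero}  P r = zero
encode {suc n} P r = combine (r zero) (encode (P ∘ suc) (r ∘ suc))

encode-injective : ∀ {n} (P : Fin n → ℕ) r s → encode P r ≡ encode P s → ∀ i → r i ≡ s i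
encode-injective {suc n} P r s eq zero    = proj₁ (combine-injective (r zero) _ (s zero) _ eq)
encode-injective {suc n} P r s eq (suc i) =
  encode-injective (P ∘ suc) (r ∘ suc) (s ∘ suc) (proj₂ (combine-injective (r zero) _ (s zero) _ eq)) i

decode : ∀ {n} (P : Fin n → ℕ) → Fin (prodFin P) → ∀ i → Fin (P i)
decode {suc n} P x zero    = proj₁ (remQuot {P zero} (prodFin (P ∘ suc)) x)
decode {suc n} P x (suc i) = decode (P ∘ suc) (proj₂ (remQuot {P zero} (prodFin (P ∘ suc)) x)) i

decode-injective : ∀ {n} (P : Fin n → ℕ) x y → (∀ i → decode P x i ≡ decode P y i) → x ≡ y
decode-injective {zero}  P zero zero eq = refl
decode-injective {suc n} P x y eq =
  trans (sym (combine-remQuot {P zero} (prodFin (P ∘ suc)) x)) (trans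
    (cong₂ combine (eq zero) (decode-injective (P ∘ suc) _ _ (eq ∘ suc)))
    (combine-remQuot {P zero} (prodFin (P ∘ suc)) y))

module _ {n : ℕ} {k : Fin n → ℕ} {Gs : ∀ i → Graph (k i)} {u : ∀ i → Fin (k i)}
         {K : ℕ} {G : Graph K} {φ : ∀ i → Fin (k i) → Fin K} (V : IsVertexGluing Gs u G φ) where
  open IsVertexGluing V

  φ-edge : ∀ i {x y} → adj (Gs i) x y ≡ true → adj G (φ i x) (φ i y) ≡ true
  φ-edge i {x} {y} xy = Equivalence.from (edgesG (φ i x) (φ i y)) (i , x , y , refl , refl , xy)

  -- Distinct pieces share only the glued vertex, so an edge common to two of them would be a loop
  -- there.
  φ-reflects : ∀ i j {x y x′ y′} → adj (Gs j) x′ y′ ≡ true → φ j x′ ≡ φ i x → φ j y′ ≡ φ i y →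
               Σ (j ≡ i) λ e → subst (Fin ∘ k) e x′ ≡ x × subst (Fin ∘ k) e y′ ≡ y
  φ-reflects i j {x} {y} {x′} {y′} xy ex ey with j ≟ i
  ... | yes refl = refl , injEach i x′ x ex , injEach i y′ y ey
  ... | no j≢i with onlyGlue j i x′ x j≢i ex | onlyGlue j i y′ y j≢i ey
  ... | refl , _ | refl , _ = contradiction (trans (sym xy) (irrefl (Gs j) (u j))) true≢false

  module _ {m : ℕ} where

    restrict : LCover G m → ∀ i → LCover (Gs i) m
    restrict C i .E a b             = E C (φ i a) (φ i b)
    restrict C i .E-sym a b         = E-sym C (φ i a) (φ i b)
    restrict C i .E-match a b ab    = E-match C (φ i a) (φ i b) (φ-edge i ab)

    part : Fin K → Fin n
    part a = proj₁ (surj a)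

    preimage : ∀ a → Fin (k (part a))
    preimage a = proj₁ (proj₂ (surj a))

    φ-preimage : ∀ a → φ (part a) (preimage a) ≡ a
    φ-preimage a = proj₂ (proj₂ (surj a))

    module _ (f : ∀ i → Fin (k i) → Fin m) (c : Fin m) (fu : ∀ i → f i (u i) ≡ c) where

      join : Fin K → Fin m
      join a = f (part a) (preimage a)

      -- Makes the preimage chosen by `join` irrelevant: two pieces overlap only in the glued
      -- vertex, where every `f i` has colour `c`.
      consistent : ∀ i j x y → φ i x ≡ φ j y → f i x ≡ f j y
      consistent i j x y eq with i ≟ j
      ... | yes refl = cong (f i) (injEach i x y eq)
      ... | no i≢j with onlyGlue i j x y i≢j eq
      ... | refl , refl = trans (fu i) (sym (fu j))

      join-φ : ∀ i x → join (φ i x) ≡ f i x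
      join-φ i x = consistent _ i _ x (φ-preimage (φ i x))

      join-proper : (C : LCover G m) → (∀ i → Proper (restrict C i) (f i)) → Proper C join
      join-proper C prop a b ab with Equivalence.to (edgesG a b) ab
      ... | i , x , y , refl , refl , xy =
        subst₂ (λ s t → E C (φ i x) (φ i y) s t ≡ false) (sym (join-φ i x)) (sym (join-φ i y)) (prop i x y xy)

    module Assemble (Cs : ∀ i → LCover (Gs i) m) where

      inPart : (i : Fin n) (a b : Fin K) → Fin m → Fin m → Set
      inPart i a b s t = ∃ λ x → ∃ λ y → φ i x ≡ a × φ i y ≡ b × adj (Gs i) x y ≡ true × E (Cs i) x y s t ≡ true

      conflict? : ∀ a b s t → Dec (∃ λ i → inPart i a b s t)
      conflict? a b s t = any? λ i → any? λ x → any? λ y →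
        (φ i x ≟ a) ×-dec (φ i y ≟ b) ×-dec (adj (Gs i) x y ≟ᵇ true) ×-dec (E (Cs i) x y s t ≟ᵇ true)

      flip : ∀ {a b s t} → (∃ λ i → inPart i a b s t) → ∃ λ i → inPart i b a t s
      flip (i , x , y , p , q , xy , e) =
        i , y , x , q , p , trans (Graph.sym (Gs i) y x) xy , trans (E-sym (Cs i) y x _ _) e

      -- Conflicts are inherited from whichever piece contains the edge. By `φ-reflects` two
      -- conflicts on the same edge come from the same piece, whose matching condition then applies.
      assemble : LCover G m
      assemble .E a b s t = does (conflict? a b s t)
      assemble .E-sym a b s t with conflict? a b s t | conflict? b a t s
      ... | yes _ | yes _ = refl
      ... | no _  | no _  = refl
      ... | yes p | no ¬q = contradiction (flip p) ¬q
      ... | no ¬p | yes q = contradiction (flip q) ¬p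
      assemble .E-match a b ab s t t′ e e′
        with does-true (conflict? a b s t) e | does-true (conflict? a b s t′) e′
      ... | i , x , y , refl , refl , xy , exy | j , x′ , y′ , px , py , xy′ , exy′
        with φ-reflects i j xy′ px py
      ... | refl , refl , refl = E-match (Cs i) x y xy s t t′ exy exy′

      piece-proper : ∀ f → Proper assemble f → ∀ i → Proper (Cs i) (f ∘ φ i)
      piece-proper f prop i x y xy with E (Cs i) x y (f (φ i x)) (f (φ i y)) in eq
      ... | false = refl
      ... | true  = contradiction (i , x , y , refl , refl , xy , eq)
        (does-false (conflict? (φ i x) (φ i y) _ _) (prop (φ i x) (φ i y) (φ-edge i xy)))

    glue-uniform : (P : Fin n → ℕ) → (∀ i → Uniform (Gs i) (u i) m (P i)) →
                   (i₀ : Fin n) → Uniform G (φ i₀ (u i₀)) m (prodFin P)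
    glue-uniform P U i₀ = record
      { lower = λ C c →
          let at = λ i → Uniform.lower (U i) (restrict C i) c
              f  = λ r i → proj₁ (at i) (decode P r i)
              ok = λ r i → proj₁ (proj₂ (at i)) (decode P r i)
              fu = λ r i → proj₂ (ok r i)
          in (λ r → join (f r) c (fu r))
           , (λ r → join-proper (f r) c (fu r) C (λ i → proj₁ (ok r i))
                  , trans (join-φ (f r) c (fu r) i₀ (u i₀)) (fu r i₀))
           , λ r s eq → decode-injective P r s λ i → proj₂ (proj₂ (at i)) _ _ λ x →
               trans (sym (join-φ (f r) c (fu r) i x)) (trans (eq (φ i x)) (join-φ (f s) c (fu s) i x))
      ; best  = assemble
      ; upper = λ c →
          let code = λ (f : Fin K → Fin m) (q : Proper assemble f × f (φ i₀ (u i₀)) ≡ c) i →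
                proj₁ (Uniform.upper (U i) c) (f ∘ φ i)
                  (piece-proper f (proj₁ q) i , trans (cong f (glue i i₀)) (proj₂ q))
          in (λ f q → encode P (code f q))
           , λ f g q q′ eq a → subst (λ a → f a ≡ g a) (φ-preimage a)
               (proj₂ (Uniform.upper (U (part a)) c) _ _ _ _
                 (encode-injective P (code f q) (code g q′) eq (part a)) (preimage a))
      }
      where open Assemble (λ i → Uniform.best (U i))

prodFin-*ˡ : ∀ {n} m (P : Fin n → ℕ) → prodFin (λ i → m * P i) ≡ m ^ n * prodFin P
prodFin-*ˡ {zero}  m P = refl
prodFin-*ˡ {suc n} m P = trans (cong (m * P zero *_) (prodFin-*ˡ m (P ∘ suc)))
  ([m*n]*[o*p]≡[m*o]*[n*p] m (P zero) (m ^ n) (prodFin (P ∘ suc)))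

prodFin-cong : ∀ {n} {P Q : Fin n → ℕ} → P ≗ Q → prodFin P ≡ prodFin Q
prodFin-cong {zero}  e = refl
prodFin-cong {suc n} e = cong₂ _*_ (e zero) (prodFin-cong (e ∘ suc))

-- The cyclic successor, and last occurrences

toℕ-csuc : ∀ {l} (i : Fin (suc l)) → toℕ (csuc i) ≡ suc (toℕ i) % suc l
toℕ-csuc i = toℕ-fromℕ< _

csuc-step : ∀ {l} (i : Fin (suc l)) → toℕ i < l → toℕ (csuc i) ≡ suc (toℕ i)
csuc-step i i<l = trans (toℕ-csuc i) (m<n⇒m%n≡m (s<s i<l))

csuc-wrap : ∀ {l} (i : Fin (suc l)) → toℕ i ≡ l → toℕ (csuc i) ≡ 0
csuc-wrap {l} i eq = trans (toℕ-csuc i) (trans (cong (λ n → suc n % suc l) eq) (n%n≡0 (suc l)))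

last-such : ∀ {Q : ℕ → Set} → (∀ n → Dec (Q n)) → Q 0 → ∀ n →
            ∃ λ i → i ≤ n × Q i × (∀ j → i < j → j ≤ n → ¬ Q j)
last-such Q? q₀ zero = 0 , z≤n , q₀ , λ { zero () _ ; (suc j) _ () }
last-such {Q} Q? q₀ (suc n) with Q? (suc n)
... | yes q = suc n , ≤-refl , q , λ j n<j j≤n _ → <-irrefl refl (<-≤-trans n<j j≤n)
... | no ¬q with last-such Q? q₀ n
... | i , i≤n , q , none = i , m≤n⇒m≤1+n i≤n , q , none′
  where
  none′ : ∀ j → i < j → j ≤ suc n → ¬ Q j
  none′ j i<j j≤ with m≤n⇒m<n∨m≡n j≤
  ... | inj₁ j<   = none j i<j (s≤s⁻¹ j<)
  ... | inj₂ refl = ¬q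

-- Dirac's theorem

module Dirac {k} (G : Graph k) where

  Adj : Fin k → Fin k → Set
  Adj a b = adj G a b ≡ true

  Adj? : ∀ a b → Dec (Adj a b)
  Adj? a b = adj G a b ≟ᵇ true

  Adj-sym : ∀ {a b} → Adj a b → Adj b a
  Adj-sym {a} {b} = trans (Graph.sym G b a)

  Adj-irrefl : ∀ {a b} → Adj a b → a ≢ b
  Adj-irrefl {a} e refl = true≢false (trans (sym e) (irrefl G a))

  -- p 0, …, p len is an induced path from s to t with interior in X.
  record Induced (X : Subset k) (s t : Fin k) : Set where
    constructor mkInduced
    field
      len    : ℕ
      p      : ℕ → Fin k
      start  : p 0 ≡ s
      end    : p len ≡ t
      link   : ∀ i → i < len → Adj (p i) (p (suc i))
      free   : ∀ i j → suc i < j → j ≤ len → ¬ Adj (p i) (p j)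
      inside : ∀ i → 0 < i → i < len → p i ∈ X

  edge-path : ∀ {X s t} → Adj s t → Induced X s t
  edge-path {s = s} {t} st = mkInduced 1 (λ { zero → s ; (suc _) → t }) refl refl
    (λ { zero _ → st ; (suc _) (s≤s ()) })
    (λ { i (suc (suc j)) _ (s≤s ()) ; i (suc zero) (s≤s ()) _ })
    (λ { (suc i) _ (s≤s ()) })

  -- Jumping from `s` to the last path vertex adjacent to it keeps the path induced: no later vertex
  -- sees `s`.
  cons-path : ∀ {X s x t} → Adj s x → x ∈ X → Induced X x t → Induced X s t
  cons-path {X} {s} {x} {t} sx x∈ (mkInduced len p start end link free inside)
    with last-such (λ n → Adj? s (p n)) (subst (Adj s) (sym start) sx) len
  ... | i , i≤ , q , none with m≤n⇒∃[o]m+o≡n i≤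
  ... | e , refl = mkInduced (suc e) p′ refl end link′ free′ inside′
    where
    p′ : ℕ → Fin k
    p′ zero    = s
    p′ (suc n) = p (i + n)
    link′ : ∀ n → n < suc e → Adj (p′ n) (p′ (suc n))
    link′ zero    _       = subst (Adj s ∘ p) (sym (+-identityʳ i)) q
    link′ (suc n) (s≤s n<e) = subst (Adj (p (i + n)) ∘ p) (sym (+-suc i n)) (link (i + n) (+-monoʳ-< i n<e))
    free′ : ∀ a b → suc a < b → b ≤ suc e → ¬ Adj (p′ a) (p′ b)
    free′ zero    (suc b) (s≤s a<b) (s≤s b≤) = none (i + b) (m<m+n i a<b) (+-monoʳ-≤ i b≤)
    free′ (suc a) (suc b) (s≤s a<b) (s≤s b≤) =
      free (i + a) (i + b) (subst (_< i + b) (+-suc i a) (+-monoʳ-< i a<b)) (+-monoʳ-≤ i b≤)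
    inside″ : ∀ j → j < i + e → p j ∈ X
    inside″ zero    _ = subst (_∈ X) (sym start) x∈
    inside″ (suc j) h = inside (suc j) z<s h
    inside′ : ∀ n → 0 < n → n < suc e → p′ n ∈ X
    inside′ (suc n) _ (s≤s n<e) = inside″ (i + n) (+-monoʳ-< i n<e)

  Link : Subset k → Fin k → Fin k → Set
  Link X a b = Adj a b × a ∈ X × b ∈ X

  walk-path : ∀ {X x z t} → Star (Link X) x z → Adj z t → Induced X x t
  walk-path ε                    zt = edge-path zt
  walk-path ((xy , _ , y∈) ◅ ys) zt = cons-path xy y∈ (walk-path ys zt)

  -- Closing an induced path by a vertex y that only sees its ends gives a
  -- chordless cycle.
  module _ (chordal : Chordal G) {X : Subset k} {s t y} (s≢t : s ≢ t) (s≁t : ¬ Adj s t)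
           (ys : Adj y s) (yt : Adj y t) (y∉ : y ∉ X) (y≁ : ∀ x → x ∈ X → ¬ Adj y x) where

    no-induced : ¬ Induced X s t
    no-induced (mkInduced zero p refl refl _ _ _) = s≢t refl
    no-induced (mkInduced (suc zero) p refl refl link _ _) = s≁t (link 0 z<s)
    -- A path of length `2 + l` has `3 + l` vertices; with `y` the cycle has length `4 + l`, the
    -- form required by `Chordal`.
    no-induced (mkInduced (suc (suc l)) p start end link free inside) =
      let i , j , i≢j , j≢ , i≢ , ij = chordal l f (f-injective , f-edge) in no-chord i j i≢j j≢ i≢ ij
      where
      len = 2 + l

      g : ℕ → Fin k
      g zero    = y
      g (suc n) = p n

      f : Fin (4 + l) → Fin k
      f i = g (toℕ i)

      -- Distinctness need not be a field of `Induced`: a repeated vertex would inherit an edge to a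
      -- vertex that is not consecutive to it, except when both ends coincide.
      p-distinct : ∀ i j → i < j → j ≤ len → p i ≢ p j
      p-distinct i j i<j j≤ eq with m≤n⇒m<n∨m≡n j≤
      ... | inj₁ j< = free i (suc j) (s<s i<j) j< (subst (λ a → Adj a (p (suc j))) (sym eq) (link j j<))
      p-distinct zero    j i<j j≤ eq | inj₂ refl = s≢t (trans (sym start) (trans eq end))
      p-distinct (suc i) j i<j j≤ eq | inj₂ refl =
        free i j i<j j≤ (subst (Adj (p i)) eq (link i (<-≤-trans (n<1+n i) (<⇒≤ i<j))))

      y-distinct : ∀ j → j ≤ len → y ≢ p j
      y-distinct zero    j≤ eq = Adj-irrefl ys (trans eq start)
      y-distinct (suc j) j≤ eq with m≤n⇒m<n∨m≡n j≤
      ... | inj₁ j<   = y∉ (subst (_∈ X) (sym eq) (inside (suc j) z<s j<))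
      ... | inj₂ refl = Adj-irrefl yt (trans eq end)

      g-distinct : ∀ i j → i < j → j ≤ suc len → g i ≢ g j
      g-distinct zero    (suc j) _         (s≤s j≤) = y-distinct j j≤
      g-distinct (suc i) (suc j) (s≤s i<j) (s≤s j≤) = p-distinct i j i<j j≤

      bound : (i : Fin (4 + l)) → toℕ i ≤ suc len
      bound = toℕ≤pred[n]

      f-injective : ∀ {i j} → f i ≡ f j → i ≡ j
      f-injective {i} {j} eq with <-cmp (toℕ i) (toℕ j)
      ... | tri< i<j _ _ = contradiction eq (g-distinct _ _ i<j (bound j))
      ... | tri≈ _ e _   = toℕ-injective e
      ... | tri> _ _ j<i = contradiction (sym eq) (g-distinct _ _ j<i (bound i))

      g-link : ∀ n → n < suc len → Adj (g n) (g (suc n))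
      g-link zero    _        = subst (Adj y) (sym start) ys
      g-link (suc n) (s≤s n<) = link n n<

      f-edge : ∀ i → Adj (f i) (f (csuc i))
      f-edge i with m≤n⇒m<n∨m≡n (bound i)
      ... | inj₁ i< = subst (λ n → Adj (f i) (g n)) (sym (csuc-step i i<)) (g-link (toℕ i) i<)
      ... | inj₂ e  = subst₂ (λ a b → Adj (g a) (g b)) (sym e) (sym (csuc-wrap i e))
                        (Adj-sym (subst (Adj y) (sym end) yt))

      g-free : ∀ a b → a < b → b ≤ suc len → b ≢ suc a → ¬ (a ≡ 0 × b ≡ suc len) → ¬ Adj (g a) (g b)
      g-free zero (suc zero)    _ _ ne _ _ = ne refl
      g-free zero (suc (suc b)) _ (s≤s b≤) _ ne e =
        y≁ _ (inside (suc b) z<s (≤∧≢⇒< b≤ (λ eq → ne (refl , cong suc eq)))) e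
      g-free (suc a) (suc b) (s≤s a<b) (s≤s b≤) ne _ =
        free a b (≤∧≢⇒< a<b (λ eq → ne (cong suc (sym eq)))) b≤

      ordered : ∀ i j → toℕ i < toℕ j → j ≢ csuc i → i ≢ csuc j → ¬ Adj (f i) (f j)
      ordered i j i<j j≢ i≢ = g-free (toℕ i) (toℕ j) i<j (bound j)
        (λ e → j≢ (toℕ-injective (trans e (sym (csuc-step i (<-≤-trans i<j (bound j)))))))
        (λ (e , e′) → i≢ (toℕ-injective (trans e (sym (csuc-wrap j e′)))))

      no-chord : ∀ i j → i ≢ j → j ≢ csuc i → i ≢ csuc j → ¬ Adj (f i) (f j)
      no-chord i j i≢j j≢ i≢ with <-cmp (toℕ i) (toℕ j)
      ... | tri< i<j _ _ = ordered i j i<j j≢ i≢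
      ... | tri≈ _ e _   = contradiction (toℕ-injective e) i≢j
      ... | tri> _ _ j<i = ordered j i j<i i≢ j≢ ∘ Adj-sym

  Simplicial : Subset k → Fin k → Set
  Simplicial W v = ∀ a b → a ∈ W → b ∈ W → Adj v a → Adj v b → a ≢ b → Adj a b

  Touches : Subset k → Fin k → Set
  Touches X a = ∃ λ x → x ∈ X × Adj a x

  touches? : ∀ X a → Dec (Touches X a)
  touches? X a = any? λ x → (x ∈? X) ×-dec Adj? a x

  Far : Subset k → Subset k → Fin k → Set
  Far W X y = y ∈ W × y ∉ X × ¬ Touches X y

  far? : ∀ W X y → Dec (Far W X y)
  far? W X y = (y ∈? W) ×-dec ¬? (y ∈? X) ×-dec ¬? (touches? X y)

  module _ (chordal : Chordal G) where

    -- If `s` and `t` were not adjacent, an induced path between them through the connected set `X`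
    -- would close up at `y`, which has no neighbour in `X`.
    boundary-adjacent : ∀ {X s t y z} → (∀ x → x ∈ X → Star (Link X) x z) →
      Touches X s → Touches X t → y ∉ X → ¬ Touches X y → Adj s y → Adj t y → s ≢ t → Adj s t
    boundary-adjacent {s = s} {t} conn (x , x∈ , sx) (x′ , x∈′ , tx′) y∉ far sy ty s≢t with Adj? s t
    ... | yes st = st
    ... | no s≁t = contradiction
      (cons-path sx x∈ (walk-path (conn x x∈ ◅◅ Star.reverse (λ (e , a , b) → Adj-sym e , b , a) (conn x′ x∈′)) (Adj-sym tx′)))
      (no-induced chordal s≢t s≁t (Adj-sym sy) (Adj-sym ty) y∉ λ x x∈ yx → far (x , x∈ , yx))

    -- A connected set X ∋ u is grown while some vertex of W far from X remains
    -- and some boundary vertex misses a far vertex.  When it stops, the boundary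
    -- is a clique complete to the far vertices, so a vertex simplicial among
    -- the far vertices is simplicial in W.
    mutual
      simplicial-avoiding : ∀ n W → ∣ W ∣ < n → ∀ u → u ∈ W → (∃ λ w → w ∈ W × w ≢ u) →
                            ∃ λ v → v ∈ W × v ≢ u × Simplicial W v
      simplicial-avoiding (suc n) W (s≤s ∣W∣≤) u u∈ (w , w∈ , w≢u)
        with any? (λ y → far? W ⁅ u ⁆ y)
      -- Two measures are at work: `n` bounds the size of `W` and pays for passing to the far
      -- vertices, while the size of the complement of `X` pays for each growth of `X`.
      ... | yes far = grow n W ∣W∣≤ u u∈ (suc ∣ ∁ ⁅ u ⁆ ∣) ⁅ u ⁆ ≤-refl (x∈⁅x⁆ u)
                        (λ x x∈ → subst (λ x → Star _ x u) (sym (x∈⁅y⁆⇒x≡y u x∈)) ε) far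
      -- Now `u` is adjacent to all the rest of `W`, so a vertex simplicial in the rest stays
      -- simplicial when `u` is put back.
      ... | no ¬far =
        let v , v∈Y , simp = simplicial-exists n Y (<-≤-trans ∣Y∣<∣W∣ ∣W∣≤) w (∈-select⁺ rest? (w∈ , w≢u))
            v∈ , v≢u = ∈-select⁻ rest? v∈Y
        in v , v∈ , v≢u , λ a b a∈ b∈ va vb a≢b → lift v simp a b a∈ b∈ va vb a≢b
        where
        rest? : ∀ x → Dec (x ∈ W × x ≢ u)
        rest? x = (x ∈? W) ×-dec ¬? (x ≟ u)
        Y = select rest?
        ∣Y∣<∣W∣ : ∣ Y ∣ < ∣ W ∣
        ∣Y∣<∣W∣ = p⊂q⇒∣p∣<∣q∣ ((λ x∈ → proj₁ (∈-select⁻ rest? x∈)) , u , u∈ , λ u∈Y → proj₂ (∈-select⁻ rest? u∈Y) refl)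
        universal : ∀ a → a ∈ W → a ≢ u → Adj a u
        universal a a∈ a≢u with touches? ⁅ u ⁆ a
        ... | yes (x , x∈ , ax) = subst (Adj a) (x∈⁅y⁆⇒x≡y u x∈) ax
        ... | no ¬t = contradiction (a , a∈ , (λ a∈u → a≢u (x∈⁅y⁆⇒x≡y u a∈u)) , ¬t) ¬far
        lift : ∀ v → Simplicial Y v → Simplicial W v
        lift v simp a b a∈ b∈ va vb a≢b with a ≟ u | b ≟ u
        ... | yes refl | yes refl = contradiction refl a≢b
        ... | yes refl | no b≢u   = Adj-sym (universal b b∈ b≢u)
        ... | no a≢u   | yes refl = universal a a∈ a≢u
        ... | no a≢u   | no b≢u   =
          simp a b (∈-select⁺ rest? (a∈ , a≢u)) (∈-select⁺ rest? (b∈ , b≢u)) va vb a≢b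

      simplicial-exists : ∀ n W → ∣ W ∣ < n → ∀ y → y ∈ W → ∃ λ v → v ∈ W × Simplicial W v
      simplicial-exists n W ∣W∣< y y∈ with any? (λ w → (w ∈? W) ×-dec ¬? (w ≟ y))
      ... | yes p = let v , v∈ , _ , simp = simplicial-avoiding n W ∣W∣< y y∈ p in v , v∈ , simp
      ... | no ¬p = y , y∈ , λ a b a∈ _ ya _ _ → contradiction (a , a∈ , Adj-irrefl ya ∘ sym) ¬p

      grow : ∀ n W → ∣ W ∣ ≤ n → ∀ u → u ∈ W → ∀ r X → ∣ ∁ X ∣ < r → u ∈ X →
             (∀ x → x ∈ X → Star (Link X) x u) → ∃ (Far W X) →
             ∃ λ v → v ∈ W × v ≢ u × Simplicial W v
      grow n W ∣W∣≤ u u∈W (suc r) X (s≤s ∣∁X∣≤) u∈ conn (y₀ , far₀)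
        with any? (λ s → (s ∈? W) ×-dec ¬? (s ∈? X) ×-dec touches? X s ×-dec
                         any? (λ y → far? W X y ×-dec ¬? (Adj? s y)))
      ... | yes (s , s∈W , s∉ , (x₀ , x₀∈ , sx₀) , y , (y∈W , y∉ , y-far) , s≁y) =
        -- As `s` touches `X`, the enlarged set stays connected; the far vertex `y` that `s` misses
        -- stays far, so the search can continue.
        grow n W ∣W∣≤ u u∈W r X′ ∣∁X′∣< (old u∈) conn′ (y , y∈W , y∉′ , y-far′)
        where
        X′ = X ∪ ⁅ s ⁆
        old : ∀ {x} → x ∈ X → x ∈ X′
        old = p⊆p∪q ⁅ s ⁆
        s∈′ : s ∈ X′
        s∈′ = q⊆p∪q X ⁅ s ⁆ (x∈⁅x⁆ s)
        case : ∀ {x} → x ∈ X′ → x ∈ X ⊎ x ≡ s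
        case x∈ with x∈p∪q⁻ X ⁅ s ⁆ x∈
        ... | inj₁ x∈X = inj₁ x∈X
        ... | inj₂ x∈s = inj₂ (x∈⁅y⁆⇒x≡y s x∈s)
        ∣∁X′∣< : ∣ ∁ X′ ∣ < r
        ∣∁X′∣< = <-≤-trans (p⊂q⇒∣p∣<∣q∣ (p⊂q⇒∁p⊃∁q (old , s , s∈′ , s∉))) ∣∁X∣≤
        up : ∀ {x z} → Star (Link X) x z → Star (Link X′) x z
        up = Star.map (λ (e , a , b) → e , old a , old b)
        conn′ : ∀ x → x ∈ X′ → Star (Link X′) x u
        conn′ x x∈ with case x∈
        ... | inj₁ x∈X  = up (conn x x∈X)
        ... | inj₂ refl = (sx₀ , s∈′ , old x₀∈) ◅ up (conn x₀ x₀∈)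
        y∉′ : y ∉ X′
        y∉′ y∈′ with case y∈′
        ... | inj₁ y∈X  = y∉ y∈X
        ... | inj₂ refl = y-far (x₀ , x₀∈ , sx₀)
        y-far′ : ¬ Touches X′ y
        y-far′ (x , x∈ , yx) with case x∈
        ... | inj₁ x∈X  = y-far (x , x∈X , yx)
        ... | inj₂ refl = s≁y (Adj-sym yx)
      ... | no maximal =
        let v , v∈Y , simp = simplicial-exists n Y (<-≤-trans ∣Y∣<∣W∣ ∣W∣≤) y₀ (∈-select⁺ (far? W X) far₀)
            v-far = ∈-select⁻ (far? W X) v∈Y
        in v , proj₁ v-far , (λ v≡u → proj₁ (proj₂ v-far) (subst (_∈ X) (sym v≡u) u∈)) ,
           lift v v-far simp
        where
        Y = select (far? W X)
        ∣Y∣<∣W∣ : ∣ Y ∣ < ∣ W ∣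
        ∣Y∣<∣W∣ = p⊂q⇒∣p∣<∣q∣ ((λ x∈ → proj₁ (∈-select⁻ (far? W X) x∈)) , u , u∈W ,
                    λ u∈Y → proj₁ (proj₂ (∈-select⁻ (far? W X) u∈Y)) u∈)
        Boundary : Fin k → Set
        Boundary a = a ∈ W × a ∉ X × Touches X a
        complete : ∀ {a y} → Boundary a → Far W X y → Adj a y
        complete {a} {y} (a∈ , a∉ , t) far with Adj? a y
        ... | yes ay = ay
        ... | no a≁y = contradiction (a , a∈ , a∉ , t , y , far , a≁y) maximal
        boundary-clique : ∀ {a b} → Boundary a → Boundary b → a ≢ b → Adj a b
        boundary-clique A@(_ , _ , ta) B@(_ , _ , tb) = boundary-adjacent conn ta tb
          (proj₁ (proj₂ far₀)) (proj₂ (proj₂ far₀)) (complete A far₀) (complete B far₀)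
        -- A neighbour of a far vertex is outside `X`, so the neighbourhood of a far vertex stays
        -- within the far and boundary vertices.
        split : ∀ {v a} → Far W X v → a ∈ W → Adj v a → Far W X a ⊎ Boundary a
        split {v} {a} (_ , _ , v-far) a∈ va with a ∈? X | touches? X a
        ... | yes a∈X | _     = contradiction (a , a∈X , va) v-far
        ... | no a∉X  | yes t = inj₂ (a∈ , a∉X , t)
        ... | no a∉X  | no ¬t = inj₁ (a∈ , a∉X , ¬t)
        lift : ∀ v → Far W X v → Simplicial Y v → Simplicial W v
        lift v v-far simp a b a∈ b∈ va vb a≢b with split v-far a∈ va | split v-far b∈ vb
        ... | inj₁ A | inj₁ B = simp a b (∈-select⁺ (far? W X) A) (∈-select⁺ (far? W X) B) va vb a≢b
        ... | inj₁ A | inj₂ B = Adj-sym (complete B A)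
        ... | inj₂ A | inj₁ B = complete A B
        ... | inj₂ A | inj₂ B = boundary-clique A B a≢b

-- Chordal graphs

_⟍_ : ∀ {k} → Graph (suc k) → Fin (suc k) → Graph k
(G ⟍ v) .adj a b       = adj G (punchIn v a) (punchIn v b)
(G ⟍ v) .Graph.sym a b = Graph.sym G (punchIn v a) (punchIn v b)
(G ⟍ v) .irrefl a      = irrefl G (punchIn v a)

⟍-chordal : ∀ {k} {G : Graph (suc k)} → Chordal G → ∀ v → Chordal (G ⟍ v)
⟍-chordal ch v l f (inj , edge) = ch l (punchIn v ∘ f) (inj ∘ punchIn-injective v _ _ , edge)

canonical : ∀ {k} (G : Graph k) m → LCover G m
canonical G m .E a b i j = does (i ≟ j)
canonical G m .E-sym a b i j with i ≟ j | j ≟ i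
... | yes _ | yes _ = refl
... | no _  | no _  = refl
... | yes p | no ¬q = contradiction (sym p) ¬q
... | no ¬p | yes q = contradiction (sym q) ¬p
canonical G m .E-match a b _ i j j′ e e′ = trans (sym (does-true (i ≟ j) e)) (does-true (i ≟ j′) e′)

data PunchView {k} (v : Fin (suc k)) : Fin (suc k) → Set where
  hole  : PunchView v v
  other : ∀ a → PunchView v (punchIn v a)

punchView : ∀ {k} (v a : Fin (suc k)) → PunchView v a
punchView v a with v ≟ a
... | yes refl = hole
... | no v≢a   = subst (PunchView v) (punchIn-punchOut v≢a) (other (punchOut v≢a))

-- Deleting a vertex and recolouring it

module _ {k} {G : Graph (suc k)} (v : Fin (suc k)) where

  neighbours? : ∀ a → Dec (adj G v a ≡ true)
  neighbours? a = adj G v a ≟ᵇ true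

  degree : ℕ
  degree = ∣ select neighbours? ∣

  no-loop : ¬ adj G v v ≡ true
  no-loop e = true≢false (trans (sym e) (irrefl G v))

  module _ {m : ℕ} (C : LCover G m) where

    _⟍ᶜ : LCover (G ⟍ v) m
    _⟍ᶜ .E a b       = E C (punchIn v a) (punchIn v b)
    _⟍ᶜ .E-sym a b   = E-sym C (punchIn v a) (punchIn v b)
    _⟍ᶜ .E-match a b = E-match C (punchIn v a) (punchIn v b)

    Blocked : (Fin k → Fin m) → Fin m → Set
    Blocked f x = ∃ λ a → adj G v (punchIn v a) ≡ true × E C v (punchIn v a) x (f a) ≡ true

    blocked? : ∀ f x → Dec (Blocked f x)
    blocked? f x = any? λ a → (adj G v (punchIn v a) ≟ᵇ true) ×-dec (E C v (punchIn v a) x (f a) ≟ᵇ true)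

    blocked : (Fin k → Fin m) → Subset m
    blocked f = select (blocked? f)

    available : (Fin k → Fin m) → Subset m
    available f = ∁ (blocked f)

    -- Each blocked colour is charged to a neighbour of `v` that blocks it; by the matching
    -- condition a neighbour blocks at most one colour.
    ∣blocked∣≤ : ∀ f → ∣ blocked f ∣ ≤ degree
    ∣blocked∣≤ f = ∣∣-≤ (blocked f)
      (λ x x∈ → rank _ (∈-select⁺ neighbours? (proj₁ (proj₂ (∈-select⁻ (blocked? f) x∈)))))
      λ x y x∈ y∈ eq → inj x y (∈-select⁻ (blocked? f) x∈) (∈-select⁻ (blocked? f) y∈)
        (rank-injective (select neighbours?) _ _ eq)
      where
      inj : ∀ x y (p : Blocked f x) (q : Blocked f y) → punchIn v (proj₁ p) ≡ punchIn v (proj₁ q) → x ≡ y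
      inj x y (a , va , e) (b , vb , e′) eq with punchIn-injective v a b eq
      ... | refl = E-match C (punchIn v a) v (trans (Graph.sym G _ v) va) (f a) x y
                     (trans (E-sym C _ v (f a) x) e) (trans (E-sym C _ v (f a) y) e′)

    ∣available∣≥ : ∀ f → m ∸ degree ≤ ∣ available f ∣
    ∣available∣≥ f = ≤-trans (∸-monoʳ-≤ m (∣blocked∣≤ f)) (≤-reflexive (sym (∣∁p∣≡n∸∣p∣ (blocked f))))

    -- Restrictions of colourings are known to agree only pointwise, so the blocked colours must be
    -- shown to respect pointwise equality.
    blocked-mono : ∀ {f g} → f ≗ g → ∀ {x} → x ∈ blocked f → x ∈ blocked g
    blocked-mono {f} {g} eq x∈ with ∈-select⁻ (blocked? f) x∈
    ... | a , va , e = ∈-select⁺ (blocked? g)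
                         (a , va , subst (λ c → E C v (punchIn v a) _ c ≡ true) (eq a) e)

    available-cong : ∀ {f g} → f ≗ g → available f ≡ available g
    available-cong eq = cong ∁ (⊆-antisym (blocked-mono eq) (blocked-mono (sym ∘ eq)))

    available⁻ : ∀ {f x} → x ∈ available f → ∀ a → adj G v (punchIn v a) ≡ true →
                 E C v (punchIn v a) x (f a) ≡ false
    available⁻ {f} {x} x∈ a va with E C v (punchIn v a) x (f a) in e
    ... | false = refl
    ... | true  = contradiction (∈-select⁺ (blocked? f) (a , va , e)) (x∈∁p⇒x∉p x∈)

    available⁺ : ∀ {f x} → (∀ a → adj G v (punchIn v a) ≡ true → E C v (punchIn v a) x (f a) ≡ false) →
                 x ∈ available f
    available⁺ {f} h = x∉p⇒x∈∁p λ x∈ → let a , va , e = ∈-select⁻ (blocked? f) x∈ in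
      true≢false (trans (sym e) (h a va))

    insert-proper : ∀ {f x} → Proper _⟍ᶜ f → x ∈ available f → Proper C (insertAt f v x)
    insert-proper {f} {x} prop x∈ a b ab with punchView v a | punchView v b
    ... | hole    | hole    = contradiction ab no-loop
    ... | hole    | other b = subst₂ (λ s t → E C v (punchIn v b) s t ≡ false)
      (sym (insertAt-lookup f v x)) (sym (insertAt-punchIn f v x b)) (available⁻ x∈ b ab)
    ... | other a | hole    = subst₂ (λ s t → E C (punchIn v a) v s t ≡ false)
      (sym (insertAt-punchIn f v x a)) (sym (insertAt-lookup f v x))
      (trans (E-sym C _ _ _ _) (available⁻ x∈ a (trans (Graph.sym G v _) ab)))
    ... | other a | other b = subst₂ (λ s t → E C (punchIn v a) (punchIn v b) s t ≡ false)
      (sym (insertAt-punchIn f v x a)) (sym (insertAt-punchIn f v x b)) (prop a b ab)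

    extend-lower : ∀ {u P c} → AtLeast (λ f → Proper _⟍ᶜ f × f u ≡ c) P →
                   AtLeast (λ f → Proper C f × f (punchIn v u) ≡ c) ((m ∸ degree) * P)
    extend-lower {u} {P} {c} (at , ok , inj) =
        (λ z → ext (proj₁ (remQuot {m ∸ degree} P z)) (proj₂ (remQuot {m ∸ degree} P z)))
      , (λ z → ext-ok _ _)
      , λ z z′ eq → trans (sym (combine-remQuot {m ∸ degree} P z))
          (trans (ext-inj _ _ _ _ eq) (combine-remQuot {m ∸ degree} P z′))
      where
      colour : Fin (m ∸ degree) → Fin P → Fin m
      colour i r = enum (available (at r)) (inject≤ i (∣available∣≥ (at r)))
      ext : Fin (m ∸ degree) → Fin P → Fin (suc k) → Fin m
      ext i r = insertAt (at r) v (colour i r)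
      ext-ok : ∀ i r → Proper C (ext i r) × ext i r (punchIn v u) ≡ c
      ext-ok i r = insert-proper (proj₁ (ok r)) (enum∈ (available (at r)) _)
                 , trans (insertAt-punchIn (at r) v _ u) (proj₂ (ok r))
      ext-inj : ∀ i r i′ r′ → ext i r ≗ ext i′ r′ → combine i r ≡ combine i′ r′
      ext-inj i r i′ r′ eq
        with inj r r′ (λ a → trans (sym (insertAt-punchIn (at r) v _ a))
                        (trans (eq (punchIn v a)) (insertAt-punchIn (at r′) v _ a)))
      ... | refl = cong (λ i → combine i r) (inject≤-injective _ _ i i′
        (enum-injective (available (at r)) (trans (sym (insertAt-lookup (at r) v _))
          (trans (eq v) (insertAt-lookup (at r) v _)))))

  module _ {m : ℕ} (simp : ∀ a b → adj G v a ≡ true → adj G v b ≡ true → a ≢ b → adj G a b ≡ true) where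

    -- The neighbours of v form a clique, so they block distinct colours.
    ∣blocked∣≥ : ∀ f → Proper (canonical (G ⟍ v) m) f → degree ≤ ∣ blocked (canonical G m) f ∣
    ∣blocked∣≥ f prop = ∣∣-≤ (select neighbours?)
      (λ a a∈ → rank (blocked (canonical G m) f) (proj₂ (at a (∈-select⁻ neighbours? a∈))))
      λ a b a∈ b∈ eq → inj a b (∈-select⁻ neighbours? a∈) (∈-select⁻ neighbours? b∈)
        (rank-injective (blocked (canonical G m) f) _ _ eq)
      where
      at : ∀ a → adj G v a ≡ true → ∃ λ x → x ∈ blocked (canonical G m) f
      at a va with punchView v a
      ... | hole    = contradiction va no-loop
      ... | other a = f a , ∈-select⁺ (blocked? (canonical G m) f) (a , va , dec-true (f a ≟ f a) refl)
      inj : ∀ a b va vb → proj₁ (at a va) ≡ proj₁ (at b vb) → a ≡ b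
      inj a b va vb eq with punchView v a | punchView v b
      ... | hole    | _       = contradiction va no-loop
      ... | other a | hole    = contradiction vb no-loop
      ... | other a | other b with punchIn v a ≟ punchIn v b
      ... | yes p = p
      ... | no ne = contradiction eq (does-false (f a ≟ f b) (prop a b (simp _ _ va vb ne)))

    ∣available∣≤ : ∀ f → Proper (canonical (G ⟍ v) m) f → ∣ available (canonical G m) f ∣ ≤ m ∸ degree
    ∣available∣≤ f prop = ≤-trans (≤-reflexive (∣∁p∣≡n∸∣p∣ (blocked (canonical G m) f))) (∸-monoʳ-≤ m (∣blocked∣≥ f prop))

    extend-upper : ∀ {u P c} → AtMost (λ f → Proper (canonical (G ⟍ v) m) f × f u ≡ c) P →
                   AtMost (λ f → Proper (canonical G m) f × f (punchIn v u) ≡ c) ((m ∸ degree) * P)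
    extend-upper {u} {P} {c} (code , inj) = (λ f q → combine (top f q) (code (f ∘ punchIn v) (rest f q))) ,
      λ f g q q′ eq a → let e , e′ = combine-injective _ _ _ _ eq
                            base   = inj _ _ _ _ e′
                        in agree f g base (same f g q q′ base e) a
      where
      Q : (Fin (suc k) → Fin m) → Set
      Q f = Proper (canonical G m) f × f (punchIn v u) ≡ c
      rest : ∀ f → Q f → Proper (canonical (G ⟍ v) m) (f ∘ punchIn v) × f (punchIn v u) ≡ c
      rest f (prop , fu) = (λ a b ab → prop (punchIn v a) (punchIn v b) ab) , fu
      free : ∀ f → Q f → f v ∈ available (canonical G m) (f ∘ punchIn v)
      free f (prop , _) = available⁺ (canonical G m) (λ a va → prop v (punchIn v a) va)
      top : ∀ f → Q f → Fin (m ∸ degree)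
      top f q = inject≤ (rank _ (free f q)) (∣available∣≤ _ (proj₁ (rest f q)))
      -- The two ranks live in `Fin` types that depend on the sets, so they are compared as natural
      -- numbers.
      rank-agree : ∀ {S T : Subset m} {x y} → S ≡ T → (x∈ : x ∈ S) (y∈ : y ∈ T) →
                   toℕ (rank S x∈) ≡ toℕ (rank T y∈) → x ≡ y
      rank-agree {S} refl x∈ y∈ eq = rank-injective S x∈ y∈ (toℕ-injective eq)
      same : ∀ f g q q′ → f ∘ punchIn v ≗ g ∘ punchIn v → top f q ≡ top g q′ → f v ≡ g v
      same f g q q′ base eq = rank-agree (available-cong (canonical G m) base) (free f q) (free g q′)
        (trans (sym (toℕ-inject≤ _ _)) (trans (cong toℕ eq) (toℕ-inject≤ _ _)))
      agree : ∀ f g → f ∘ punchIn v ≗ g ∘ punchIn v → f v ≡ g v → f ≗ g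
      agree f g base top≡ a with punchView v a
      ... | hole    = top≡
      ... | other a = base a

-- The optimal cover is fixed in advance so that the induction closes: deleting a vertex from the
-- identity cover leaves the identity cover, and in it a clique of neighbours receives distinct
-- colours, which block as many colours as possible.
record CanonicallyUniform {k} (G : Graph k) (u : Fin k) (m : ℕ) : Set where
  field
    count : ℕ
    lower : ∀ (C : LCover G m) c → AtLeast (λ f → Proper C f × f u ≡ c) count
    upper : ∀ c → AtMost (λ f → Proper (canonical G m) f × f u ≡ c) count

single-vertex : (G : Graph 1) → ∀ u m → CanonicallyUniform G u m
single-vertex G zero m = record
  { count = 1
  ; lower = λ C c → (λ _ _ → c)
      , (λ _ → (λ { zero zero e → contradiction (trans (sym e) (irrefl G zero)) true≢false }) , refl)
      , λ { zero zero _ → refl }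
  ; upper = λ c → (λ _ _ → zero) , λ { f g (_ , p) (_ , q) _ zero → trans p (sym q) }
  }

add-simplicial : ∀ {k} (G : Graph (suc k)) v u m → v ≢ u →
  (∀ a b → adj G v a ≡ true → adj G v b ≡ true → a ≢ b → adj G a b ≡ true) →
  (∀ u′ → CanonicallyUniform (G ⟍ v) u′ m) → CanonicallyUniform G u m
add-simplicial G v u m v≢u simp IH with punchView v u
... | hole     = contradiction refl v≢u
... | other u′ = record
  { count = (m ∸ degree {G = G} v) * CanonicallyUniform.count (IH u′)
  ; lower = λ C c → extend-lower v C (CanonicallyUniform.lower (IH u′) (_⟍ᶜ v C) c)
  ; upper = λ c → extend-upper {G = G} v simp (CanonicallyUniform.upper (IH u′) c)
  }

chordal-canonical : ∀ k (G : Graph (suc k)) → Chordal G → ∀ u m → CanonicallyUniform G u m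
chordal-canonical zero    G ch u m = single-vertex G u m
chordal-canonical (suc k) G ch u m =
  let v , _ , v≢u , simp = Dirac.simplicial-avoiding G ch _ ⊤ ≤-refl u ∈⊤ (punchIn u zero , ∈⊤ , punchInᵢ≢i u zero)
  in add-simplicial G v u m v≢u (λ a b → simp a b ∈⊤ ∈⊤)
       (λ u′ → chordal-canonical k (G ⟍ v) (⟍-chordal {G = G} ch v) u′ m)

chordal-uniform : ∀ {k} (G : Graph k) → Chordal G → ∀ u m → ∃ (Uniform G u m)
chordal-uniform {suc k} G ch u m = count , record { lower = lower ; best = canonical G m ; upper = upper }
  where open CanonicallyUniform (chordal-canonical k G ch u m)

-- Finite sums

sum-mono : ∀ {n} {f g : Fin n → ℕ} → (∀ i → f i ≤ g i) → sum f ≤ sum g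
sum-mono {zero}  h = z≤n
sum-mono {suc n} h = +-mono-≤ (h zero) (sum-mono (h ∘ suc))

sum-const : ∀ n a → sum {n} (λ _ → a) ≡ n * a
sum-const zero    a = refl
sum-const (suc n) a = cong (a +_) (sum-const n a)

term≤sum : ∀ {n} (f : Fin n → ℕ) i → f i ≤ sum f
term≤sum {suc n} f i = subst (f i ≤_) (sym (sum-remove {i = i} f)) (m≤m+n (f i) _)

unpack : ∀ {n} (g : Fin n → ℕ) → Fin (sum g) → Σ (Fin n) (Fin ∘ g)
unpack {suc n} g r with splitAt (g zero) r
... | inj₁ s = zero , s
... | inj₂ s = let i , t = unpack (g ∘ suc) s in suc i , t

pack : ∀ {n} (g : Fin n → ℕ) → Σ (Fin n) (Fin ∘ g) → Fin (sum g)
pack {suc n} g (zero  , s) = s ↑ˡ sum (g ∘ suc)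
pack {suc n} g (suc i , s) = g zero ↑ʳ pack (g ∘ suc) (i , s)

pack-unpack : ∀ {n} (g : Fin n → ℕ) r → pack g (unpack g r) ≡ r
pack-unpack {suc n} g r with splitAt (g zero) r in eq
... | inj₁ s = splitAt⁻¹-↑ˡ eq
... | inj₂ s = trans (cong (g zero ↑ʳ_) (pack-unpack (g ∘ suc) s)) (splitAt⁻¹-↑ʳ eq)

unpack-pack : ∀ {n} (g : Fin n → ℕ) s → unpack g (pack g s) ≡ s
unpack-pack {suc n} g (zero  , s) rewrite splitAt-↑ˡ (g zero) s (sum (g ∘ suc)) = refl
unpack-pack {suc n} g (suc i , s)
  rewrite splitAt-↑ʳ (g zero) (sum (g ∘ suc)) (pack (g ∘ suc) (i , s)) | unpack-pack (g ∘ suc) (i , s) = refl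

-- The Boolean is a conflict, and a conflict closes the gate; sums over allowed continuations can
-- thus range over all colours.
gate : Bool → ℕ → ℕ
gate true  n = 0
gate false n = n

gate-closed : ∀ {b} → b ≡ true → ∀ n → gate b n ≡ 0
gate-closed refl n = refl

gate-open : ∀ {b} → b ≡ false → ∀ n → gate b n ≡ n
gate-open refl n = refl

ungate : ∀ b {n} → Fin (gate b n) → Fin n
ungate false i = i

ungate-false : ∀ b {n} → Fin (gate b n) → b ≡ false
ungate-false false i = refl

ungate-injective : ∀ b {n} {i j : Fin (gate b n)} → ungate b i ≡ ungate b j → i ≡ j
ungate-injective false e = e

ingate : ∀ {b n} → b ≡ false → Fin n → Fin (gate b n)
ingate refl i = i

toℕ-ingate : ∀ {b n} (e : b ≡ false) (i : Fin n) → toℕ (ingate e i) ≡ toℕ i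
toℕ-ingate refl i = refl

-- A row of a matching closes at most one term, so gating loses at most the single value `g y`.
gate-sum : ∀ {n} (r : Fin (suc n) → Bool) (g : Fin (suc n) → ℕ) →
           (∀ x y → r x ≡ true → r y ≡ true → x ≡ y) →
           ∃ λ y → sum g ≤ sum (λ x → gate (r x) (g x)) + g y
gate-sum {n} r g one with any? (λ y → r y ≟ᵇ true)
-- Nothing is lost here, so any index serves as witness.
... | no none = zero , ≤-trans (≤-reflexive (sum-cong-≗ λ x → sym (gate-open (¬-not (λ e → none (x , e))) (g x)))) (m≤m+n _ _)
... | yes (y , ry) = y , (begin
    sum g                                  ≡⟨ sum-remove {i = y} g ⟩
    g y + sum (g ∘ punchIn y)              ≡⟨ cong (g y +_) (sum-cong-≗ λ z → sym (gate-open (¬-not λ e → punchInᵢ≢i y z (one _ _ e ry)) _)) ⟩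
    g y + sum (h ∘ punchIn y)              ≤⟨ +-monoʳ-≤ (g y) (m≤n+m _ (h y)) ⟩
    g y + (h y + sum (h ∘ punchIn y))      ≡⟨ cong (g y +_) (sum-remove {i = y} h) ⟨
    g y + sum h                            ≡⟨ +-comm (g y) (sum h) ⟩
    sum h + g y                            ∎)
  where
  open ≤-Reasoning
  h : Fin (suc n) → ℕ
  h x = gate (r x) (g x)

gate-const : ∀ {n} (r : Fin (suc n) → Bool) a → (∀ x y → r x ≡ true → r y ≡ true → x ≡ y) →
             n * a ≤ sum (λ x → gate (r x) a)
gate-const {n} r a one = +-cancelʳ-≤ a (n * a) _ (≤-trans
  (≤-reflexive (trans (+-comm (n * a) a) (sym (sum-const (suc n) a)))) (proj₂ (gate-sum r (λ _ → a) one)))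

-- Walks through a sequence of conflict relations

-- walks c M t x counts the sequences x = w 0, …, w t = c such that w i and
-- w (i + 1) do not conflict under M i.
walks : ∀ {m} → Fin m → (ℕ → Fin m → Fin m → Bool) → ℕ → Fin m → ℕ
walks c M zero    x = gate (not (does (x ≟ c))) 1
walks c M (suc t) x = sum (λ y → gate (M 0 x y) (walks c (M ∘ suc) t y))

IsWalk : ∀ {m} → (ℕ → Fin m → Fin m → Bool) → ℕ → (ℕ → Fin m) → Set
IsWalk M t w = ∀ i → i < t → M i (w i) (w (suc i)) ≡ false

module _ {m} (c : Fin m) where

  private
    next : (ℕ → Fin m → Fin m → Bool) → ℕ → Fin m → Fin m → ℕ
    next M t x y = gate (M 0 x y) (walks c (M ∘ suc) t y)

  build : ∀ t M x → Fin (walks c M t x) → ℕ → Fin m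
  build zero    M x r _       = x
  build (suc t) M x r zero    = x
  build (suc t) M x r (suc i) =
    build t (M ∘ suc) (proj₁ (unpack (next M t x) r)) (ungate (M 0 x _) (proj₂ (unpack (next M t x) r))) i

  build-start : ∀ t M x r → build t M x r 0 ≡ x
  build-start zero    M x r = refl
  build-start (suc t) M x r = refl

  build-end : ∀ t M x r → build t M x r t ≡ c
  build-end zero    M x r with x ≟ c
  ... | yes p = p
  build-end (suc t) M x r = build-end t (M ∘ suc) _ _

  build-walk : ∀ t M x r → IsWalk M t (build t M x r)
  build-walk (suc t) M x r zero    _        = trans (cong (M 0 x) (build-start t (M ∘ suc) _ _))
    (ungate-false (M 0 x _) (proj₂ (unpack (next M t x) r)))
  build-walk (suc t) M x r (suc i) (s≤s i<) = build-walk t (M ∘ suc) _ _ i i<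

  build-injective : ∀ t M x r s → (∀ i → i ≤ t → build t M x r i ≡ build t M x s i) → r ≡ s
  build-injective zero M x r s eq with x ≟ c
  build-injective zero M x zero zero eq | yes _ = refl
  build-injective (suc t) M x r s eq =
    trans (sym (pack-unpack (next M t x) r)) (trans (cong (pack (next M t x))
      (tails _ _ _ _ (trans (sym (build-start t (M ∘ suc) _ _)) (trans (eq 1 (s≤s z≤n)) (build-start t (M ∘ suc) _ _)))
         (λ i i≤ → eq (suc i) (s≤s i≤))))
      (pack-unpack (next M t x) s))
    where
    tails : ∀ y y′ (r : Fin (next M t x y)) (s : Fin (next M t x y′)) → y ≡ y′ →
            (∀ i → i ≤ t → build t (M ∘ suc) y (ungate (M 0 x y) r) i ≡ build t (M ∘ suc) y′ (ungate (M 0 x y′) s) i) →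
            _≡_ {A = Σ (Fin m) (Fin ∘ next M t x)} (y , r) (y′ , s)
    tails y y r s refl e = cong (y ,_) (ungate-injective (M 0 x y) (build-injective t (M ∘ suc) y _ _ e))

  code : ∀ t M x w → w 0 ≡ x → w t ≡ c → IsWalk M t w → Fin (walks c M t x)
  code zero    M x w w₀ wₜ walk = ingate (cong not (dec-true (x ≟ c) (trans (sym w₀) wₜ))) zero
  code (suc t) M x w w₀ wₜ walk = pack (next M t x)
    (w 1 , ingate (subst (λ x → M 0 x (w 1) ≡ false) w₀ (walk 0 z<s))
             (code t (M ∘ suc) (w 1) (w ∘ suc) refl wₜ (λ i i< → walk (suc i) (s<s i<))))

  -- The codes of two tails have types depending on `w 1` and `w′ 1`, whose equality is itself part
  -- of the conclusion; hence the comparison through `toℕ`.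
  code-injective : ∀ t M x x′ w w′ w₀ w₀′ wₜ wₜ′ walk walk′ → x ≡ x′ →
    toℕ (code t M x w w₀ wₜ walk) ≡ toℕ (code t M x′ w′ w₀′ wₜ′ walk′) → ∀ i → i ≤ t → w i ≡ w′ i
  code-injective t M x x w w′ w₀ w₀′ _ _ _ _ refl eq zero _ = trans w₀ (sym w₀′)
  code-injective (suc t) M x x w w′ w₀ w₀′ wₜ wₜ′ walk walk′ refl eq (suc i) (s≤s i≤) =
    code-injective t (M ∘ suc) (w 1) (w′ 1) (w ∘ suc) (w′ ∘ suc) refl refl wₜ wₜ′ _ _ (cong proj₁ pairs)
      (trans (sym (toℕ-ingate _ _)) (trans (cong (toℕ ∘ proj₂) pairs) (toℕ-ingate _ _))) i i≤
    where
    pairs = trans (sym (unpack-pack (next M t x) _))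
      (trans (cong (unpack (next M t x)) (toℕ-injective eq)) (unpack-pack (next M t x) _))

-- Extremal numbers of closed walks

-- Consecutive relations join different lists and need not be symmetric, so both directions of the
-- matching are stated.
record Matchings {m} (M : ℕ → Fin m → Fin m → Bool) : Set where
  field
    row    : ∀ t x y y′ → M t x y ≡ true → M t x y′ ≡ true → y ≡ y′
    column : ∀ t x x′ y → M t x y ≡ true → M t x′ y ≡ true → x ≡ x′

later : ∀ {m} {M : ℕ → Fin m → Fin m → Bool} → Matchings M → Matchings (M ∘ suc)
later 𝓜 = record { row = Matchings.row 𝓜 ∘ suc ; column = Matchings.column 𝓜 ∘ suc }

module _ (q : ℕ) where

  -- The smaller of the numbers of closed and non-closed walks of length t in
  -- the complete graph on 2 + q vertices with prescribed ends.
  μ : ℕ → ℕ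
  μ zero          = 0
  μ (suc zero)    = 0
  μ (suc (suc t)) = q * suc q ^ t + μ t

  module _ (c : Fin (2 + q)) where

    total : (ℕ → Fin (2 + q) → Fin (2 + q) → Bool) → ℕ → ℕ
    total M t = sum (walks c M t)

    one≤total : ∀ M → 1 ≤ total M 0
    one≤total M = ≤-trans (≤-reflexive (sym (gate-open (cong not (dec-true (c ≟ c) refl)) 1)))
                    (term≤sum (walks c M 0) c)

    -- Exchanging the sums groups the walks by their tail: each tail starting at `y` can be preceded
    -- by all colours but at most one, hence by at least `suc q`.
    total-≥ : ∀ t {M} → Matchings M → suc q ^ t ≤ total M t
    total-≥ zero    {M} 𝓜 = one≤total M
    total-≥ (suc t) {M} 𝓜 = begin
      suc q * suc q ^ t                                        ≤⟨ *-monoʳ-≤ (suc q) (total-≥ t (later 𝓜)) ⟩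
      suc q * total (M ∘ suc) t                                ≡⟨ *-distribˡ-sum (suc q) (walks c (M ∘ suc) t) ⟩
      sum (λ y → suc q * walks c (M ∘ suc) t y)                ≤⟨ sum-mono (λ y → gate-const (λ x → M 0 x y) (walks c (M ∘ suc) t y) (λ x x′ → Matchings.column 𝓜 0 x x′ y)) ⟩
      sum (λ y → sum λ x → gate (M 0 x y) (walks c (M ∘ suc) t y)) ≡⟨ ∑-comm (λ x y → gate (M 0 x y) (walks c (M ∘ suc) t y)) ⟨
      total M (suc t)                                          ∎
      where open ≤-Reasoning

    -- Only the q + 1 rows other than x can meet the columns, so some column
    -- is met by none of them.
    unmatched : ∀ {M} → Matchings M → ∀ x → ∃ λ y → ∀ z → M 0 (punchIn x z) y ≡ false
    unmatched {M} 𝓜 x with all? (λ y → any? λ z → M 0 (punchIn x z) y ≟ᵇ true)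
    ... | yes met = contradiction
      (injective⇒≤ {f = λ y → proj₁ (met y)} λ {y} {y′} e →
        Matchings.row 𝓜 0 (punchIn x (proj₁ (met y))) y y′ (proj₂ (met y))
          (subst (λ z → M 0 (punchIn x z) y′ ≡ true) (sym e) (proj₂ (met y′))))
      (<⇒≱ (n<1+n (suc q)))
    ... | no ¬met with ¬∀⟶∃¬ (2 + q) _ (λ y → any? λ z → M 0 (punchIn x z) y ≟ᵇ true) ¬met
    ... | y , none = y , λ z → ¬-not λ e → none (z , e)

    mutual
      -- The first step excludes at most one continuation `y`; `others-≥` bounds what remains of the
      -- total without `y`.
      walks-≥ : ∀ t {M} → Matchings M → ∀ x → μ t ≤ walks c M t x
      walks-≥ zero          𝓜 x = z≤n
      walks-≥ (suc t) {M} 𝓜 x with gate-sum (M 0 x) (walks c (M ∘ suc) t) (Matchings.row 𝓜 0 x)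
      ... | y , le = +-cancelˡ-≤ (walks c (M ∘ suc) t y) (μ (suc t)) _
        (≤-trans (others-≥ t (later 𝓜) y) (≤-trans le (≤-reflexive (+-comm _ (walks c (M ∘ suc) t y)))))

      -- Of the `suc q` starts other than `x`, each tail is compatible with at least `q`, and tails
      -- from an unmatched `y₀` with all of them. This gives `q` times the total number of tails
      -- plus one extra `W y₀`, the two summands in the recursion of `μ`.
      others-≥ : ∀ t {M} → Matchings M → ∀ x → walks c M t x + μ (suc t) ≤ total M t
      others-≥ zero    {M} 𝓜 x = ≤-trans (≤-reflexive (+-identityʳ _)) (term≤sum (walks c M 0) x)
      others-≥ (suc t) {M} 𝓜 x with unmatched 𝓜 x
      ... | y₀ , none = begin
        walks c M (suc t) x + (q * suc q ^ t + μ t)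
          ≤⟨ +-monoʳ-≤ (walks c M (suc t) x) rest ⟩
        walks c M (suc t) x + sum (walks c M (suc t) ∘ punchIn x)
          ≡⟨ sum-remove {i = x} (walks c M (suc t)) ⟨
        total M (suc t) ∎
        where
        open ≤-Reasoning
        W = walks c (M ∘ suc) t
        h : Fin (2 + q) → ℕ
        h y = sum λ z → gate (M 0 (punchIn x z) y) (W y)
        h-≥ : ∀ y → q * W y ≤ h y
        h-≥ y = gate-const (λ z → M 0 (punchIn x z) y) (W y)
          λ z z′ e e′ → punchIn-injective x z z′ (Matchings.column 𝓜 0 _ _ y e e′)
        h₀ : h y₀ ≡ suc q * W y₀
        h₀ = trans (sum-cong-≗ λ z → gate-open (none z) (W y₀)) (sum-const (suc q) (W y₀))
        rest : q * suc q ^ t + μ t ≤ sum (walks c M (suc t) ∘ punchIn x)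
        rest = begin
          q * suc q ^ t + μ t
            ≤⟨ +-mono-≤ (*-monoʳ-≤ q (total-≥ t (later 𝓜))) (walks-≥ t (later 𝓜) y₀) ⟩
          q * sum W + W y₀
            ≡⟨ cong (_+ W y₀) (*-distribˡ-sum q W) ⟩
          sum (λ y → q * W y) + W y₀
            ≡⟨ cong (_+ W y₀) (sum-remove {i = y₀} (λ y → q * W y)) ⟩
          q * W y₀ + sum (λ z → q * W (punchIn y₀ z)) + W y₀
            ≡⟨ +-comm _ (W y₀) ⟩
          W y₀ + (q * W y₀ + sum (λ z → q * W (punchIn y₀ z)))
            ≡⟨ +-assoc (W y₀) (q * W y₀) _ ⟨
          suc q * W y₀ + sum (λ z → q * W (punchIn y₀ z))
            ≤⟨ +-mono-≤ (≤-reflexive (sym h₀)) (sum-mono (λ z → h-≥ (punchIn y₀ z))) ⟩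
          h y₀ + sum (h ∘ punchIn y₀)
            ≡⟨ sum-remove {i = y₀} h ⟨
          sum h
            ≡⟨ ∑-comm (λ z y → gate (M 0 (punchIn x z) y) (W y)) ⟨
          sum (walks c M (suc t) ∘ punchIn x) ∎

    -- Walks in the complete graph

    same : ℕ → Fin (2 + q) → Fin (2 + q) → Bool
    same _ x y = does (x ≟ y)

    -- With identity conflicts the first step from `x` may go anywhere except `x`, so exactly the
    -- walks starting again at `x` are missing from the total.
    walks-same-suc : ∀ t x → walks c same (suc t) x + walks c same t x ≡ total same t
    walks-same-suc t x = begin
      sum h + W x                         ≡⟨ cong (_+ W x) (sum-remove {i = x} h) ⟩
      h x + sum (h ∘ punchIn x) + W x     ≡⟨ cong (λ a → a + sum (h ∘ punchIn x) + W x) (gate-closed (dec-true (x ≟ x) refl) (W x)) ⟩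
      sum (h ∘ punchIn x) + W x           ≡⟨ cong (_+ W x) (sum-cong-≗ λ z → gate-open (dec-false (x ≟ punchIn x z) (λ e → punchInᵢ≢i x z (sym e))) (W (punchIn x z))) ⟩
      sum (W ∘ punchIn x) + W x           ≡⟨ +-comm _ (W x) ⟩
      W x + sum (W ∘ punchIn x)           ≡⟨ sum-remove {i = x} W ⟨
      sum W                               ∎
      where
      open ≡-Reasoning
      W = walks c same t
      h : Fin (2 + q) → ℕ
      h y = gate (does (x ≟ y)) (W y)

    total-same-suc : ∀ t → total same (suc t) ≡ suc q * total same t
    total-same-suc t = +-cancelʳ-≡ (total same t) _ _ (begin
      total same (suc t) + total same t                           ≡⟨ ∑-distrib-+ (walks c same (suc t)) (walks c same t) ⟨
      sum (λ x → walks c same (suc t) x + walks c same t x)       ≡⟨ sum-cong-≗ (walks-same-suc t) ⟩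
      sum {2 + q} (λ _ → total same t)                                ≡⟨ sum-const (2 + q) (total same t) ⟩
      total same t + suc q * total same t                         ≡⟨ +-comm (total same t) _ ⟩
      suc q * total same t + total same t                         ∎)
      where open ≡-Reasoning

    total-same : ∀ t → total same t ≡ suc q ^ t
    total-same zero = trans (sum-remove {i = c} (walks c same 0)) (cong₂ _+_
      (gate-open (cong not (dec-true (c ≟ c) refl)) 1)
      (trans (sum-cong-≗ λ z → gate-closed (cong not (dec-false (_ ≟ c) (punchInᵢ≢i c z))) 1)
             (sum-replicate-zero (suc q))))
    total-same (suc t) = trans (total-same-suc t) (cong (suc q *_) (total-same t))

    -- Comparing `walks-same-suc` at two consecutive lengths eliminates the alternation and leaves
    -- the recursion of `μ`.
    walks-same-2+ : ∀ t x → walks c same (2 + t) x ≡ q * suc q ^ t + walks c same t x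
    walks-same-2+ t x = +-cancelʳ-≡ (walks c same (suc t) x) _ _ (begin
      walks c same (2 + t) x + walks c same (suc t) x              ≡⟨ walks-same-suc (suc t) x ⟩
      total same (suc t)                                           ≡⟨ total-same-suc t ⟩
      total same t + q * total same t                              ≡⟨ +-comm (total same t) _ ⟩
      q * total same t + total same t                              ≡⟨ cong₂ _+_ (cong (q *_) (total-same t)) (trans (sym (walks-same-suc t x)) (+-comm _ (walks c same t x))) ⟩
      q * suc q ^ t + (walks c same t x + walks c same (suc t) x)  ≡⟨ +-assoc (q * suc q ^ t) (walks c same t x) _ ⟨
      q * suc q ^ t + walks c same t x + walks c same (suc t) x    ∎)
      where open ≡-Reasoning

    -- The relation between the ends that makes the number of walks minimal.
    Extremal : ℕ → Fin (2 + q) → Set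
    Extremal zero          x = x ≢ c
    Extremal (suc zero)    x = x ≡ c
    Extremal (suc (suc t)) x = Extremal t x

    walks-same-extremal : ∀ t x → Extremal t x → walks c same t x ≡ μ t
    walks-same-extremal zero x x≢c = gate-closed (cong not (dec-false (x ≟ c) x≢c)) 1
    walks-same-extremal (suc zero) x refl = +-cancelʳ-≡ (walks c same 0 c) _ 0 (trans (walks-same-suc 0 c)
      (trans (total-same 0) (sym (gate-open (cong not (dec-true (c ≟ c) refl)) 1))))
    walks-same-extremal (suc (suc t)) x ext =
      trans (walks-same-2+ t x) (cong (q * suc q ^ t +_) (walks-same-extremal t x ext))

-- Cycles

csuc-injective : ∀ {l} → Injective _≡_ _≡_ (csuc {l})
csuc-injective {l} {i} {j} eq with m≤n⇒m<n∨m≡n (toℕ≤pred[n] i) | m≤n⇒m<n∨m≡n (toℕ≤pred[n] j)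
... | inj₁ i< | inj₁ j< = toℕ-injective (ℕ.suc-injective (trans (sym (csuc-step i i<)) (trans (cong toℕ eq) (csuc-step j j<))))
... | inj₁ i< | inj₂ j≡ = contradiction (trans (sym (csuc-step i i<)) (trans (cong toℕ eq) (csuc-wrap j j≡))) λ ()
... | inj₂ i≡ | inj₁ j< = contradiction (trans (sym (csuc-step j j<)) (trans (cong toℕ (sym eq)) (csuc-wrap i i≡))) λ ()
... | inj₂ i≡ | inj₂ j≡ = toℕ-injective (trans i≡ (sym j≡))

csuc-fixedpointfree : ∀ {l} (i : Fin (2 + l)) → i ≢ csuc i
csuc-fixedpointfree i eq with m≤n⇒m<n∨m≡n (toℕ≤pred[n] i)
... | inj₁ i< = <-irrefl (trans (cong toℕ eq) (csuc-step i i<)) (n<1+n _)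
... | inj₂ i≡ = contradiction (trans (sym i≡) (trans (cong toℕ eq) (csuc-wrap i i≡))) λ ()

[m%n+o]%n≡[m+o]%n : ∀ m o n .{{_ : NonZero n}} → (m % n + o) % n ≡ (m + o) % n
[m%n+o]%n≡[m+o]%n m o n = trans (%-distribˡ-+ (m % n) o n)
  (trans (cong (λ a → (a + o % n) % n) (m%n%n≡m%n m n)) (sym (%-distribˡ-+ m o n)))

-- One turn around a cycle, starting and ending at u.
record Tour {k} (G : Graph k) (u : Fin k) (l : ℕ) : Set where
  Next : (Fin k → ℕ) → Fin k → Fin k → Set
  Next pos a b = pos b ≡ suc (pos a) ⊎ (suc (pos a) ≡ l × pos b ≡ 0)
  field
    long    : 3 ≤ l
    v       : ℕ → Fin k
    pos     : Fin k → ℕ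
    v-start : v 0 ≡ u
    v-end   : v l ≡ u
    v-edge  : ∀ t → adj G (v t) (v (suc t)) ≡ true
    pos<    : ∀ a → pos a < l
    v-pos   : ∀ a → v (pos a) ≡ a
    pos-v   : ∀ t → t < l → pos (v t) ≡ t
    adj-pos : ∀ a b → adj G a b ≡ true → Next pos a b ⊎ Next pos b a

tour : ∀ {k} {G : Graph k} ((j , _) : IsCycleGraph G) u → Tour G u (3 + j)
tour {k} {G} (j , σ , iff) u = record
  { long    = s≤s (s≤s (s≤s z≤n))
  ; v       = v
  ; pos     = pos
  ; v-start = to-injective (toℕ-injective (trans (to-v 0) (trans (cong (_% l) (+-identityʳ s)) (small u))))
  ; v-end   = to-injective (toℕ-injective (trans (to-v l) (trans ([m+n]%n≡m%n s l) (small u))))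
  ; v-edge  = λ t → Equivalence.from (iff (v t) (v (suc t))) (inj₁ (toℕ-injective (begin
      toℕ (to (v (suc t)))       ≡⟨ to-v (suc t) ⟩
      (s + suc t) % l            ≡⟨ cong (_% l) (trans (+-suc s t) (+-comm 1 (s + t))) ⟩
      (s + t + 1) % l            ≡⟨ [m%n+o]%n≡[m+o]%n (s + t) 1 l ⟨
      ((s + t) % l + 1) % l      ≡⟨ cong (λ a → (a + 1) % l) (to-v t) ⟨
      (toℕ (to (v t)) + 1) % l   ≡⟨ cong (_% l) (+-comm (toℕ (to (v t))) 1) ⟩
      suc (toℕ (to (v t))) % l   ≡⟨ toℕ-csuc (to (v t)) ⟨
      toℕ (csuc (to (v t)))      ∎)))
  ; pos<    = λ a → m%n<n (toℕ (to a) + (l ∸ s)) l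
  ; v-pos   = λ a → to-injective (toℕ-injective (begin
      toℕ (to (v (pos a)))                 ≡⟨ to-v (pos a) ⟩
      (s + pos a) % l                      ≡⟨ cong (_% l) (+-comm s (pos a)) ⟩
      (pos a + s) % l                      ≡⟨ [m%n+o]%n≡[m+o]%n (toℕ (to a) + (l ∸ s)) s l ⟩
      (toℕ (to a) + (l ∸ s) + s) % l       ≡⟨ cong (_% l) (trans (+-assoc (toℕ (to a)) (l ∸ s) s) (cong (toℕ (to a) +_) (trans (+-comm (l ∸ s) s) s+))) ⟩
      (toℕ (to a) + l) % l                 ≡⟨ [m+n]%n≡m%n (toℕ (to a)) l ⟩
      toℕ (to a) % l                       ≡⟨ small a ⟩
      toℕ (to a)                           ∎))
  ; pos-v   = λ t t<l → begin
      (toℕ (to (v t)) + (l ∸ s)) % l       ≡⟨ cong (λ a → (a + (l ∸ s)) % l) (to-v t) ⟩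
      ((s + t) % l + (l ∸ s)) % l          ≡⟨ [m%n+o]%n≡[m+o]%n (s + t) (l ∸ s) l ⟩
      (s + t + (l ∸ s)) % l                ≡⟨ cong (_% l) (trans (cong (_+ (l ∸ s)) (+-comm s t)) (trans (+-assoc t s (l ∸ s)) (cong (t +_) s+))) ⟩
      (t + l) % l                          ≡⟨ [m+n]%n≡m%n t l ⟩
      t % l                                ≡⟨ m<n⇒m%n≡m t<l ⟩
      t                                    ∎
  ; adj-pos = λ a b ab → adj-pos a b (Equivalence.to (iff a b) ab)
  }
  where
  open ≡-Reasoning
  open Inverse σ using (to; from; strictlyInverseˡ; strictlyInverseʳ)
  l = 3 + j
  s = toℕ (to u)
  s+ : s + (l ∸ s) ≡ l
  s+ = m+[n∸m]≡n (<⇒≤ (toℕ<n (to u)))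
  v : ℕ → Fin k
  v t = from ((s + t) mod l)
  -- `l ∸ s` is the additive inverse of `s` modulo `l`, so this undoes the rotation by `s` in `v`
  -- that puts `u` at position 0.
  pos : Fin k → ℕ
  pos a = (toℕ (to a) + (l ∸ s)) % l
  to-injective : ∀ {a b} → to a ≡ to b → a ≡ b
  to-injective {a} {b} e = trans (sym (strictlyInverseʳ a)) (trans (cong from e) (strictlyInverseʳ b))
  to-v : ∀ t → toℕ (to (v t)) ≡ (s + t) % l
  to-v t = trans (cong toℕ (strictlyInverseˡ _)) (toℕ-fromℕ< _)
  small : ∀ a → toℕ (to a) % l ≡ toℕ (to a)
  small a = m<n⇒m%n≡m (toℕ<n (to a))
  next : ∀ a b → to b ≡ csuc (to a) → pos b ≡ suc (pos a) % l
  next a b e = begin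
    (toℕ (to b) + (l ∸ s)) % l                ≡⟨ cong (λ x → (x + (l ∸ s)) % l) (trans (cong toℕ e) (toℕ-csuc (to a))) ⟩
    (suc (toℕ (to a)) % l + (l ∸ s)) % l      ≡⟨ [m%n+o]%n≡[m+o]%n (suc (toℕ (to a))) (l ∸ s) l ⟩
    suc (toℕ (to a) + (l ∸ s)) % l            ≡⟨ cong (_% l) (+-comm 1 (toℕ (to a) + (l ∸ s))) ⟩
    (toℕ (to a) + (l ∸ s) + 1) % l            ≡⟨ [m%n+o]%n≡[m+o]%n (toℕ (to a) + (l ∸ s)) 1 l ⟨
    (pos a + 1) % l                           ≡⟨ cong (_% l) (+-comm (pos a) 1) ⟩
    suc (pos a) % l                           ∎
  next′ : ∀ a b → to b ≡ csuc (to a) → pos b ≡ suc (pos a) ⊎ (suc (pos a) ≡ l × pos b ≡ 0)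
  next′ a b e with m≤n⇒m<n∨m≡n (m%n<n (toℕ (to a) + (l ∸ s)) l)
  ... | inj₁ lt = inj₁ (trans (next a b e) (m<n⇒m%n≡m lt))
  ... | inj₂ eq = inj₂ (eq , trans (next a b e) (trans (cong (_% l) eq) (n%n≡0 l)))
  adj-pos : ∀ a b → cycleAdj (to a) (to b) →
            (pos b ≡ suc (pos a) ⊎ (suc (pos a) ≡ l × pos b ≡ 0)) ⊎ (pos a ≡ suc (pos b) ⊎ (suc (pos b) ≡ l × pos a ≡ 0))
  adj-pos a b (inj₁ e) = inj₁ (next′ a b e)
  adj-pos a b (inj₂ e) = inj₂ (next′ b a e)

module _ {k} {G : Graph k} {u : Fin k} {l : ℕ} (tr : Tour G u l) where
  open Tour tr

  0<l : 0 < l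
  0<l = <⇒≤ (<⇒≤ long)

  pos-u : pos u ≡ 0
  pos-u = trans (cong pos (sym v-start)) (pos-v 0 0<l)

  module _ (q : ℕ) where

    module _ (C : LCover G (2 + q)) (c : Fin (2 + q)) where

      conflicts : ℕ → Fin (2 + q) → Fin (2 + q) → Bool
      conflicts t = E C (v t) (v (suc t))

      conflicts-matchings : Matchings conflicts
      conflicts-matchings = record
        { row    = λ t x y y′ → E-match C _ _ (v-edge t) x y y′
        ; column = λ t x x′ y e e′ → E-match C _ _ (trans (Graph.sym G _ _) (v-edge t)) y x x′
                     (trans (E-sym C _ _ y x) e) (trans (E-sym C _ _ y x′) e′)
        }

      module _ (w : ℕ → Fin (2 + q)) (w-start : w 0 ≡ c) (w-end : w l ≡ c) (walk : IsWalk conflicts l w) where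

        forward : ∀ a b → Next pos a b → E C a b (w (pos a)) (w (pos b)) ≡ false
        forward a b nxt = subst₂ (λ x y → E C a x (w (pos a)) y ≡ false) (proj₁ (arrive nxt)) (proj₂ (arrive nxt))
          (subst (λ x → E C x (v (suc (pos a))) (w (pos a)) (w (suc (pos a))) ≡ false) (v-pos a) (walk (pos a) (pos< a)))
          where
          arrive : Next pos a b → v (suc (pos a)) ≡ b × w (suc (pos a)) ≡ w (pos b)
          arrive (inj₁ e) = trans (cong v (sym e)) (v-pos b) , cong w (sym e)
          arrive (inj₂ (e , e′)) =
              trans (cong v e) (trans v-end (trans (sym v-start) (trans (cong v (sym e′)) (v-pos b))))
            , trans (cong w e) (trans w-end (trans (sym w-start) (cong w (sym e′))))

        walk-proper : Proper C (w ∘ pos)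
        walk-proper a b ab with adj-pos a b ab
        ... | inj₁ e = forward a b e
        ... | inj₂ e = trans (E-sym C a b _ _) (forward b a e)

      cycle-lower : AtLeast (λ f → Proper C f × f u ≡ c) (μ q l)
      cycle-lower = (λ r → w r ∘ pos)
        , (λ r → walk-proper (w r) (build-start c l _ c (at r)) (build-end c l _ c (at r)) (build-walk c l _ c (at r))
               , trans (cong (w r) pos-u) (build-start c l _ c (at r)))
        , λ r s eq → inject≤-injective _ _ r s (build-injective c l conflicts c (at r) (at s) (agree r s eq))
        where
        at : Fin (μ q l) → Fin (walks c conflicts l c)
        at r = inject≤ r (walks-≥ q c l conflicts-matchings c)
        w : Fin (μ q l) → ℕ → Fin (2 + q)
        w r = build c l conflicts c (at r)
        agree : ∀ r s → w r ∘ pos ≗ w s ∘ pos → ∀ i → i ≤ l → w r i ≡ w s i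
        agree r s eq i i≤ with m≤n⇒m<n∨m≡n i≤
        ... | inj₁ i< = trans (cong (w r) (sym (pos-v i i<))) (trans (eq (v i)) (cong (w s) (pos-v i i<)))
        -- Index `l` is not a value of `pos`, but both walks end in `c` there.
        ... | inj₂ refl = trans (build-end c l _ c (at r)) (sym (build-end c l _ c (at s)))

    -- The extremal cover of a cycle

    Closing : Fin k → Fin k → Set
    Closing a b = suc (pos a) ≡ l × pos b ≡ 0

    closing? : ∀ a b → Dec (Closing a b)
    closing? a b = (suc (pos a) ≟ⁿ l) ×-dec (pos b ≟ⁿ 0)

    closing-asym : ∀ {a b} → Closing a b → ¬ Closing b a
    closing-asym (p , _) (_ , q) = <-irrefl (trans (cong suc (sym q)) p) (<⇒≤ long)

    module _ (τ : Fin (2 + q) → Fin (2 + q)) (τ-injective : Injective _≡_ _≡_ τ) where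

      -- Only the edge from the last position back to position 0 carries `τ`; the second clause is
      -- the same matching read in the other direction.
      twist : ∀ {a b} → Dec (Closing a b) → Dec (Closing b a) → Fin (2 + q) → Fin (2 + q) → Bool
      twist (yes _) _       i j = does (i ≟ τ j)
      twist (no _)  (yes _) i j = does (j ≟ τ i)
      twist (no _)  (no _)  i j = does (i ≟ j)

      does-≟-sym : (i j : Fin (2 + q)) → does (i ≟ j) ≡ does (j ≟ i)
      does-≟-sym = E-sym (canonical G (2 + q)) u u

      twisted : LCover G (2 + q)
      twisted .E a b = twist (closing? a b) (closing? b a)
      twisted .E-sym a b i j with closing? a b | closing? b a
      ... | yes p | yes q = contradiction q (closing-asym {a} {b} p)
      ... | yes _ | no _  = refl
      ... | no _  | yes _ = refl
      ... | no _  | no _  = does-≟-sym i j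
      twisted .E-match a b _ i j j′ e e′ with closing? a b | closing? b a
      ... | yes _ | _     = τ-injective (trans (sym (does-true (i ≟ τ j) e)) (does-true (i ≟ τ j′) e′))
      ... | no _  | yes _ = trans (does-true (j ≟ τ i) e) (sym (does-true (j′ ≟ τ i) e′))
      ... | no _  | no _  = trans (sym (does-true (i ≟ j) e)) (does-true (i ≟ j′) e′)

      -- The closing edge forbids f u = c exactly when the last colour is τ c, so
      -- a proper colouring is a walk of the complete graph from c to τ c.
      module _ (c : Fin (2 + q)) (f : Fin k → Fin (2 + q)) (prop : Proper twisted f) (fu : f u ≡ c) where

        unroll : ℕ → Fin (2 + q)
        unroll i with i <?ⁿ l
        ... | yes _ = f (v i)
        ... | no _  = τ c

        unroll-< : ∀ i → i < l → unroll i ≡ f (v i)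
        unroll-< i i< with i <?ⁿ l
        ... | yes _ = refl
        ... | no ≮  = contradiction i< ≮

        unroll-end : unroll l ≡ τ c
        unroll-end with l <?ⁿ l
        ... | yes l<l = contradiction l<l (<-irrefl refl)
        ... | no _  = refl

        open-edge : ∀ i → suc i < l → does (f (v i) ≟ f (v (suc i))) ≡ false
        open-edge i i< with closing? (v i) (v (suc i)) | closing? (v (suc i)) (v i) | prop (v i) (v (suc i)) (v-edge i)
        ... | yes (_ , p) | _ | _ = contradiction (trans (sym (pos-v (suc i) i<)) p) λ ()
        -- Here `i` is 0 and the reversed edge is the closing one, which would force `l` to be 2.
        ... | no _ | yes (p , p′) | _ = contradiction long (<-irrefl
              (trans (sym (cong suc (trans (pos-v (suc i) i<) (cong suc (trans (sym (pos-v i (<⇒≤ i<))) p′))))) p))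
        ... | no _ | no _ | e = e

        closing-edge : ∀ i → suc i ≡ l → does (f (v i) ≟ τ c) ≡ false
        closing-edge i i≡ with closing? (v i) u | prop (v i) u (subst (λ a → adj G (v i) a ≡ true) (trans (cong v i≡) v-end) (v-edge i))
        ... | yes _ | e = subst (λ c → does (f (v i) ≟ τ c) ≡ false) fu e
        ... | no ¬p | _ = contradiction (trans (cong suc (pos-v i (subst (i <_) i≡ (n<1+n i)))) i≡ , pos-u) ¬p

        unroll-walk : IsWalk (same q (τ c)) l unroll
        unroll-walk i i< with m≤n⇒m<n∨m≡n i<
        ... | inj₁ i+1< = subst₂ (λ x y → does (x ≟ y) ≡ false) (sym (unroll-< i i<)) (sym (unroll-< (suc i) i+1<)) (open-edge i i+1<)
        ... | inj₂ refl = subst₂ (λ x y → does (x ≟ y) ≡ false) (sym (unroll-< i i<)) (sym unroll-end) (closing-edge i refl)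

      cycle-upper : ∀ c → Extremal q (τ c) l c → AtMost (λ f → Proper twisted f × f u ≡ c) (μ q l)
      cycle-upper c ext = (λ f (prop , fu) → subst Fin size (index f prop fu))
        , λ f g (pf , fu) (pg , gu) eq a → trans (cong f (sym (v-pos a))) (trans
            (trans (sym (unroll-< c f pf fu (pos a) (pos< a)))
              (trans (code-injective (τ c) l (same q (τ c)) c c _ _ _ _ _ _ _ _ refl
                        (cong toℕ (subst-Fin-injective size eq)) (pos a) (<⇒≤ (pos< a)))
                     (unroll-< c g pg gu (pos a) (pos< a))))
            (cong g (v-pos a)))
        where
        size : walks (τ c) (same q (τ c)) l c ≡ μ q l
        size = walks-same-extremal q (τ c) l c ext
        index : ∀ f → Proper twisted f → f u ≡ c → Fin (walks (τ c) (same q (τ c)) l c)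
        index f prop fu = code (τ c) l (same q (τ c)) c (unroll c f prop fu)
          (trans (unroll-< c f prop fu 0 0<l) (trans (cong f v-start) fu))
          (unroll-end c f prop fu) (unroll-walk c f prop fu)

    -- For odd length `τ c` must equal `c` and the identity serves; for even length it must differ
    -- from `c` for every `c`, and the cyclic shift has no fixed point because there are at least
    -- two colours.
    extremal-twist : ∀ t → ∃ λ (τ : Fin (2 + q) → Fin (2 + q)) → Injective _≡_ _≡_ τ × (∀ c → Extremal q (τ c) t c)
    extremal-twist zero          = csuc , csuc-injective , csuc-fixedpointfree
    extremal-twist (suc zero)    = id , id , λ c → refl
    extremal-twist (suc (suc t)) = extremal-twist t

  tour-uniform : ∀ m → ∃ (Uniform G u m)
  tour-uniform zero = 0 , record { lower = λ C () ; best = canonical G 0 ; upper = λ () }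
  -- With one colour, an identity matching on any edge rules out all colourings, so the value is 0.
  tour-uniform (suc zero) = 0 , record
    { lower = λ C c → (λ ()) , (λ ()) , λ ()
    ; best  = canonical G 1
    ; upper = λ c → (λ f (prop , _) → contradiction (one (f (v 0)) (f (v 1)))
                (does-false (f (v 0) ≟ f (v 1)) (prop (v 0) (v 1) (v-edge 0))))
            , λ f g (prop , _) → contradiction (one (f (v 0)) (f (v 1)))
                (does-false (f (v 0) ≟ f (v 1)) (prop (v 0) (v 1) (v-edge 0)))
    }
    where
    one : (x y : Fin 1) → x ≡ y
    one zero zero = refl
  tour-uniform (suc (suc q)) = let τ , inj , ext = extremal-twist q l in μ q l , record
    { lower = cycle-lower q
    ; best  = twisted q τ inj
    ; upper = λ c → cycle-upper q τ inj c (ext c)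
    }

cycle-uniform : ∀ {k} (G : Graph k) → IsCycleGraph G → ∀ u m → ∃ (Uniform G u m)
cycle-uniform G cyc u = tour-uniform (tour cyc u)

-- The product formula

theorem1p12 : (n : ℕ) → 2 ≤ n →
    (k : Fin n → ℕ) (Gs : (i : Fin n) → Graph (k i)) →
    (∀ i → Chordal (Gs i) ⊎ IsCycleGraph (Gs i)) →
    (u : (i : Fin n) → Fin (k i)) →
    {K : ℕ} (G : Graph K) (φ : (i : Fin n) → Fin (k i) → Fin K) →
    IsVertexGluing Gs u G φ →
    (m : ℕ) (p : Fin n → ℕ) → (∀ i → IsPDP (Gs i) m (p i)) →
    Σ ℕ (λ q → IsPDP G m q × q * m ^ (n ∸ 1) ≡ prodFin p)
theorem1p12 (suc n) _ k Gs kind u G φ V m p pdp =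
  m * prodFin P , uniform⇒PDP (glue-uniform V P (λ i → proj₂ (U i)) zero) , (begin
    m * prodFin P * m ^ n        ≡⟨ *-comm (m * prodFin P) (m ^ n) ⟩
    m ^ n * (m * prodFin P)      ≡⟨ *-assoc (m ^ n) m (prodFin P) ⟨
    m ^ n * m * prodFin P        ≡⟨ cong (_* prodFin P) (*-comm (m ^ n) m) ⟩
    m ^ suc n * prodFin P        ≡⟨ prodFin-*ˡ m P ⟨
    -- Each given `p i` is a minimum, hence equal to the value `m * P i` that uniformity yields.
    prodFin (λ i → m * P i)      ≡⟨ prodFin-cong (λ i → PDP-unique (uniform⇒PDP (proj₂ (U i))) (pdp i)) ⟩
    prodFin p                    ∎)
  where
  open ≡-Reasoning
  U : ∀ i → ∃ (Uniform (Gs i) (u i) m)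
  U i = [ (λ ch → chordal-uniform (Gs i) ch (u i) m) , (λ cyc → cycle-uniform (Gs i) cyc (u i) m) ]′ (kind i)
  P : Fin (suc n) → ℕ
  P i = proj₁ (U i)
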